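{- Fix $\alpha\in(0,1)$ and an integer $\lambda\ge0$. For the online time-critical task scheduling with calibration problem in which all jobs are $\alpha$-short window jobs (i.e., $d_j-r_j<\alpha T+\lambda$), with unit processing times and activation time $\lambda$, there exists an online algorithm with competitive ratio $(e+1)(\lambda+1)\lceil\frac{2}{1-\alpha}\rceil$.
   Context: Problem: unlimited identical machines; discrete time. A calibration started at integer time $t$ occupies $[t,t+\lambda+T)$, with activation interval $[t,t+\lambda)$ and calibrated interval $[t+\lambda,t+\lambda+T)$ ($T$ a positive integer). Machines process jobs only while calibrated, one job at a time. Each job $j$ has integer release time $r_j$, processing time $1$, integer deadline $d_j$ with $d_j-r_j\ge1+\lambda$; scheduling $j$ at integer time $\tau$ in a calibrated slot is feasible iff $r_j\le\tau$ and $\tau+1\le d_j$. Jobs arrive online (revealed at release time). Objective: minimize the number of calibrations while feasibly scheduling all jobs. An online algorithm is $c$-competitive if there is a constant $a$ with $ALG(Ins)\le c\cdot OPT(Ins)+a$ for every instance, where $OPT(Ins)$ is the minimum number of calibrations.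
   Formalization: The parameter α is taken rational instead of real in (0,1); the real case follows by replacing α with 1−2/⌈2/(1−α)⌉, which is rational, at least α, and has the same ceiling. -}

module Defs where

open import Data.Nat using (ℕ; zero; suc; _+_; _*_; _∸_; _≤_; _<_; _!)
open import Data.Nat.Properties using (_!≢0)
open import Data.Integer as ℤ using (ℤ; +_; +[1+_]; -[1+_])
open import Data.Rational as ℚ using (ℚ; mkℚ; _/_; _÷_; ceiling) renaming (_+_ to _+ℚ_; _-_ to _-ℚ_; _≤_ to _≤ℚ_)
open import Data.List using (List; []; length; lookup; map; upTo)
open import Data.Nat.ListAction using (sum)
open import Data.List.Relation.Unary.All using (All)
open import Data.List.Relation.Unary.Unique.Propositional using (Unique)
open import Data.List.Membership.Propositional using (_∈_)
open import Data.Vec using (Vec; tabulate)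
open import Data.Fin using (Fin; toℕ)
open import Data.Product using (Σ; ∃; _×_; _,_; proj₁; proj₂)
open import Relation.Binary.PropositionalEquality using (_≡_)
open import Function.Definitions using (Injective)

ℕ→ℚ : ℕ → ℚ
ℕ→ℚ n = + n / 1

ℤ→ℚ : ℤ → ℚ
ℤ→ℚ z = z / 1

-- ⌈ 2 / (1 - α) ⌉  (library division and ceiling; the value returned when
-- 1 - α = 0 is an irrelevant junk value, since the theorem assumes α < 1)
ceil2div1minus : ℚ → ℤ
ceil2div1minus α with 1ℚ' -ℚ α
  where 1ℚ' = + 1 / 1
... | q@(mkℚ +[1+ n ] _ _) = ceiling ((+ 2 / 1) ÷ q)
... | q@(mkℚ -[1+ n ] _ _) = ceiling ((+ 2 / 1) ÷ q)
... | mkℚ (+ zero) _ _     = + 0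

eSum : ℕ → ℚ
eSum zero    = + 1 / 1
eSum (suc n) = eSum n +ℚ ((+ 1 / (suc n !)) {{suc n !≢0}})

-- eUpper n = Σ_{k=0}^{n+1} 1/k! + 1/((n+1)·(n+1)!)  > e, and eUpper n ↓ e.
eUpper : ℕ → ℚ
eUpper n = eSum (suc n) +ℚ ((+ 1 / (suc n * suc n !)) {{nz}})
  where
  nz : Data.Nat.NonZero (suc n * suc n !)
  nz = Data.Nat.Properties.m*n≢0 (suc n) (suc n !) {{_}} {{suc n !≢0}}

-- "q > e" : q dominates one of the upper bounds eUpper n.
-- (The set of such q is exactly the open ray (e, ∞).)
AboveE : ℚ → Set
AboveE q = ∃ λ n → eUpper n ≤ℚ q

-- Instances.  Times are natural numbers.  arr t is the list of deadlines
-- of the jobs released at time t; job (t , i) is the i-th job released at t.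

record Instance : Set where
  field
    arr     : ℕ → List ℕ
    horizon : ℕ
    finite  : ∀ t → horizon ≤ t → arr t ≡ []
open Instance public

Job : Instance → Set
Job I = Σ ℕ λ s → Fin (length (arr I s))

release : (I : Instance) → Job I → ℕ
release I (s , i) = s

deadline : (I : Instance) → Job I → ℕ
deadline I (s , i) = lookup (arr I s) i

WellFormed : (lam : ℕ) → Instance → Set
WellFormed lam I = ∀ (j : Job I) → release I j + suc lam ≤ deadline I j

AlphaShort : (α : ℚ) (T lam : ℕ) → Instance → Set
AlphaShort α T lam I = ∀ (j : Job I) →
  ℕ→ℚ (deadline I j ∸ release I j) ℚ.< (α ℚ.* ℕ→ℚ T) +ℚ ℕ→ℚ lam

-- Offline schedules (unlimited machines).  A schedule is a list of
-- calibration start times and a placement of each job into a slot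
-- (calibration, integer time τ); at most one job per slot.

record Schedule (T lam : ℕ) (I : Instance) : Set where
  field
    cals  : List ℕ
    place : Job I → Fin (length cals) × ℕ
    inj   : Injective _≡_ _≡_ place
    rel   : ∀ j → release I j ≤ proj₂ (place j)
    dl    : ∀ j → suc (proj₂ (place j)) ≤ deadline I j
    calLo : ∀ j → lookup cals (proj₁ (place j)) + lam ≤ proj₂ (place j)
    calHi : ∀ j → proj₂ (place j) < lookup cals (proj₁ (place j)) + lam + T
open Schedule public

-- Online (deterministic) algorithms.
-- At time t the algorithm sees the history arr 0 , … , arr t (all jobs
-- released so far) and decides (a) how many calibrations to start at t and
-- (b) which jobs to process at t, on which calibrations.
-- A job id is (release time s , index i); a calibration id is
-- (start time u , k) meaning the k-th calibration started at time u.

JobId : Set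
JobId = ℕ × ℕ

CalId : Set
CalId = ℕ × ℕ

record Decision : Set where
  field
    calibs : ℕ
    runs   : List (JobId × CalId)
open Decision public

OnlineAlg : Set
OnlineAlg = (t : ℕ) → Vec (List ℕ) (suc t) → Decision

history : Instance → (t : ℕ) → Vec (List ℕ) (suc t)
history I t = tabulate (λ i → arr I (toℕ i))

dec : OnlineAlg → Instance → ℕ → Decision
dec A I t = A t (history I t)

CalibratedAt : (T lam : ℕ) → OnlineAlg → Instance → CalId → ℕ → Set
CalibratedAt T lam A I (u , k) t =
  (k < calibs (dec A I u)) × (u + lam ≤ t) × (t < u + lam + T)

LegalRun : (T lam : ℕ) → OnlineAlg → Instance → ℕ → JobId × CalId → Set
LegalRun T lam A I t ((s , i) , c) =
  Σ (i < length (arr I s)) λ _ →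
    (s ≤ t) × (∀ (j : Fin (length (arr I s))) → toℕ j ≡ i → suc t ≤ lookup (arr I s) j)
    × CalibratedAt T lam A I c t

Feasible : (T lam : ℕ) → OnlineAlg → Instance → Set
Feasible T lam A I =
  (∀ t → All (LegalRun T lam A I t) (runs (dec A I t)))
  × (∀ t → Unique (map proj₂ (runs (dec A I t))))
  × (∀ (j : Job I) → ∃ λ t → ∃ λ c → ((proj₁ j , toℕ (proj₂ j)) , c) ∈ runs (dec A I t))

algCalibs : OnlineAlg → Instance → ℕ → ℕ
algCalibs A I N = sum (map (λ t → calibs (dec A I t)) (upTo N))

{-# OPTIONS --safe #-}
module Submission where

-- Delay every job by lam: replacing each calibration of an offline schedule by lam + 1
-- copies, started 0, …, lam steps later, accommodates the delayed jobs, so this costs a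
-- factor lam + 1 and hides the activation time.
--
-- With k = ⌈2/(1-α)⌉ cut the release times into blocks of length L = ⌈2T/k⌉ and treat the
-- blocks separately.  All jobs of a block live in a window of length T, so a calibration
-- opened for the block lasts until its end; and a calibrated interval meets the windows
-- of at most k blocks.
--
-- Inside a block let m be the largest density ⌈#{jobs with window in [b,D)}/(D-b)⌉ of the
-- jobs seen so far, a lower bound on the number of calibrations meeting the block's window,
-- and run EDF on 3m machines.  If EDF missed a deadline D, then for some s the jobs due by
-- D and released in [s,D) would exceed the capacity of [s,D).  But at distance x from D,
-- m is at least 1/(2x) times the number of such jobs released at distance between x and 2x,
-- so ∑ m counts a job released at distance z with weight ∑_{z/2≤x≤z} 1/(2x) ≥ 1/3.
-- Finally 3 < e + 1.

open import Defs
open import Data.List using (length)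
open import Data.Nat.Tactic.RingSolver using (solve-∀)
open import Data.Product using (Σ; _×_; _,_; proj₁; proj₂; ∃)
open import Relation.Binary.PropositionalEquality hiding (J; [_])
open import Relation.Nullary.Negation using (contradiction)

module Combinatorics where

  open import Data.Fin using (Fin; toℕ; fromℕ<)
  open import Data.Fin.Properties using (toℕ<n; toℕ-injective; toℕ-fromℕ<)
  open import Data.List using ([]; _∷_; _++_; List; allFin; applyUpTo; cartesianProduct; concatMap; drop; filter; lookup; map; take; upTo; zip)
  open import Data.List.Membership.Propositional using (_∈_; find; lose)
  open import Data.List.Membership.Propositional.Properties
  open import Data.List.Properties using (length-++; length-map; length-upTo; length-applyUpTo; length-tabulate; filter-++; filter-none; filter-accept; filter-reject; concatMap-cong; map-concatMap; map-∘; map-applyUpTo)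
  open import Data.List.Relation.Binary.Permutation.Propositional using (_↭_; ↭-sym)
  open import Data.List.Relation.Binary.Permutation.Propositional.Properties using (↭-length; filter-↭; ∈-resp-↭; shift)
  open import Data.List.Relation.Unary.All as All using ([]; _∷_)
  open import Data.List.Relation.Unary.AllPairs using (AllPairs; []; _∷_)
  open import Data.List.Relation.Unary.Any using (here; there)
  open import Data.List.Relation.Unary.Linked.Properties using (Linked⇒AllPairs)
  open import Data.List.Relation.Unary.Unique.Propositional using (Unique)
  import Data.List.Relation.Unary.Unique.Propositional.Properties as Unique
  import Data.List.Sort as Sort
  open import Data.Nat
  open import Data.Nat.DivMod
  open import Data.Nat.Divisibility using (_∣_; divides; ∣-trans; m∣m*n; m≤n⇒m!∣n!)
  open import Data.Nat.ListAction using (sum)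
  open import Data.Nat.Properties
  open import Data.Sum using (_⊎_; inj₁; inj₂)
  open import Data.Vec as Vec using (Vec)
  open import Data.Vec.Properties using (lookup∘tabulate)
  open import Function using (_∘_; id)
  import Relation.Binary.Construct.On as On
  open import Relation.Nullary using (Dec; yes; no; ¬_)
  open import Relation.Nullary.Decidable using (_×-dec_; decidable-stable)

  -- Finite sums over initial segments of the naturals.

  ∑ : ℕ → (ℕ → ℕ) → ℕ
  ∑ zero    f = 0
  ∑ (suc n) f = ∑ n f + f n

  ∑-cong : ∀ n {f g} → (∀ i → i < n → f i ≡ g i) → ∑ n f ≡ ∑ n g
  ∑-cong zero    eq = refl
  ∑-cong (suc n) eq = cong₂ _+_ (∑-cong n λ i i<n → eq i (m<n⇒m<1+n i<n)) (eq n ≤-refl)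

  ∑-mono-≤ : ∀ n {f g} → (∀ i → i < n → f i ≤ g i) → ∑ n f ≤ ∑ n g
  ∑-mono-≤ zero    le = z≤n
  ∑-mono-≤ (suc n) le = +-mono-≤ (∑-mono-≤ n λ i i<n → le i (m<n⇒m<1+n i<n)) (le n ≤-refl)

  ∑-zero : ∀ n {f} → (∀ i → i < n → f i ≡ 0) → ∑ n f ≡ 0
  ∑-zero zero    eq = refl
  ∑-zero (suc n) eq = cong₂ _+_ (∑-zero n λ i i<n → eq i (m<n⇒m<1+n i<n)) (eq n ≤-refl)

  ∑-split : ∀ m n f → ∑ (m + n) f ≡ ∑ m f + ∑ n (λ i → f (m + i))
  ∑-split m zero    f rewrite +-identityʳ m = sym (+-identityʳ _)
  ∑-split m (suc n) f rewrite +-suc m n | ∑-split m n f = +-assoc (∑ m f) _ _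

  ∑-monoˡ-≤ : ∀ f {m n} → m ≤ n → ∑ m f ≤ ∑ n f
  ∑-monoˡ-≤ f {m} {n} m≤n = begin
    ∑ m f                                 ≤⟨ m≤m+n _ _ ⟩
    ∑ m f + ∑ (n ∸ m) (λ i → f (m + i))   ≡⟨ ∑-split m (n ∸ m) f ⟨
    ∑ (m + (n ∸ m)) f                     ≡⟨ cong (λ k → ∑ k f) (m+[n∸m]≡n m≤n) ⟩
    ∑ n f                                 ∎
    where open ≤-Reasoning

  ∑-distrib-+ : ∀ n f g → ∑ n (λ i → f i + g i) ≡ ∑ n f + ∑ n g
  ∑-distrib-+ zero    f g = refl
  ∑-distrib-+ (suc n) f g rewrite ∑-distrib-+ n f g = interchange (∑ n f) (∑ n g) (f n) (g n)
    where
    interchange : ∀ a b c d → a + b + (c + d) ≡ a + c + (b + d)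
    interchange = solve-∀

  *-distribˡ-∑ : ∀ c n f → c * ∑ n f ≡ ∑ n (λ i → c * f i)
  *-distribˡ-∑ c zero    f = *-zeroʳ c
  *-distribˡ-∑ c (suc n) f = trans (*-distribˡ-+ c (∑ n f) (f n)) (cong (_+ c * f n) (*-distribˡ-∑ c n f))

  ∑-swap : ∀ m n (f : ℕ → ℕ → ℕ) → ∑ m (λ i → ∑ n (f i)) ≡ ∑ n (λ j → ∑ m (λ i → f i j))
  ∑-swap zero    n f = sym (∑-zero n λ _ _ → refl)
  ∑-swap (suc m) n f = trans (cong (_+ ∑ n (f m)) (∑-swap m n f))
                             (sym (∑-distrib-+ n (λ j → ∑ m (λ i → f i j)) (f m)))

  ∑-shift-≤ : ∀ a c {K} f → a + c ≤ K → ∑ c (λ i → f (a + i)) ≤ ∑ K f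
  ∑-shift-≤ a c {K} f a+c≤K = begin
    ∑ c (λ i → f (a + i))          ≤⟨ m≤n+m _ _ ⟩
    ∑ a f + ∑ c (λ i → f (a + i))  ≡⟨ ∑-split a c f ⟨
    ∑ (a + c) f                    ≤⟨ ∑-monoˡ-≤ f a+c≤K ⟩
    ∑ K f                          ∎
    where open ≤-Reasoning

  ∑-restrict-≤ : ∀ a c {K} f → a + c ≤ K → (∀ i → i < a → f i ≡ 0) →
                 (∀ i → i < K → a + c ≤ i → f i ≡ 0) → ∑ K f ≤ ∑ c (λ i → f (a + i))
  ∑-restrict-≤ a c {K} f a+c≤K lo hi = begin
    ∑ K f                                        ≡⟨ cong (λ k → ∑ k f) (m+[n∸m]≡n a+c≤K) ⟨
    ∑ (a + c + d) f                              ≡⟨ ∑-split (a + c) d f ⟩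
    ∑ (a + c) f + ∑ d (λ i → f (a + c + i))      ≡⟨ cong₂ _+_ (∑-split a c f) (∑-zero d above) ⟩
    ∑ a f + ∑ c (λ i → f (a + i)) + 0            ≡⟨ +-identityʳ _ ⟩
    ∑ a f + ∑ c (λ i → f (a + i))                ≡⟨ cong (_+ ∑ c (λ i → f (a + i))) (∑-zero a lo) ⟩
    ∑ c (λ i → f (a + i))                        ∎
    where
    open ≤-Reasoning
    d : ℕ
    d = K ∸ (a + c)
    above : ∀ i → i < d → f (a + c + i) ≡ 0
    above i i<d = hi (a + c + i)
      (≤-trans (+-monoʳ-< (a + c) i<d) (≤-reflexive (m+[n∸m]≡n a+c≤K))) (m≤m+n _ _)

  -- Harmonic sums and the density inequality.

  ∑-descending : ∀ w n → 4 * w * n ≤ 2 * ∑ n (λ i → 2 * w ∸ i) + n * n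
  ∑-descending w zero    rewrite *-zeroʳ (4 * w) = z≤n
  ∑-descending w (suc n) = begin
    4 * w * suc n                                       ≡⟨ e₁ w n ⟩
    -- Truncated subtraction can only enlarge a summand, so the induction runs without assuming
    -- `n ≤ 2 * w`.
    4 * w * n + 2 * (2 * w)                             ≤⟨ +-mono-≤ (∑-descending w n) (*-monoʳ-≤ 2 (m≤n+m∸n (2 * w) n)) ⟩
    2 * S + n * n + 2 * (n + (2 * w ∸ n))               ≤⟨ m≤n+m _ 1 ⟩
    1 + (2 * S + n * n + 2 * (n + (2 * w ∸ n)))         ≡⟨ e₂ S n (2 * w ∸ n) ⟩
    2 * (S + (2 * w ∸ n)) + suc n * suc n               ∎
    where
    open ≤-Reasoning
    S : ℕ
    S = ∑ n (λ i → 2 * w ∸ i)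
    e₁ : ∀ w n → 4 * w * suc n ≡ 4 * w * n + 2 * (2 * w)
    e₁ = solve-∀
    e₂ : ∀ S n r → 1 + (2 * S + n * n + 2 * (n + r)) ≡ 2 * (S + r) + suc n * suc n
    e₂ = solve-∀

  -- x (3w - x) ≤ (3w/2)² at x = w + i: the tangent to 1/x at 3w/2 lies below 1/x.
  4x[3w∸x]≤9w² : ∀ w i → i ≤ w → 4 * ((w + i) * (2 * w ∸ i)) ≤ 9 * (w * w)
  4x[3w∸x]≤9w² w i i≤w = subst (λ v → 4 * ((v + i) * (2 * v ∸ i)) ≤ 9 * (v * v)) (m+[n∸m]≡n i≤w) (go i (w ∸ i))
    where
    open ≤-Reasoning
    square : ∀ a b → 4 * (a * b) ≤ (a + b) * (a + b)
    square a b with ≤-total a b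
    ... | inj₁ a≤b = subst (λ c → 4 * (a * c) ≤ (a + c) * (a + c)) (m+[n∸m]≡n a≤b)
                          (≤-trans (m≤m+n _ _) (≤-reflexive (e a (b ∸ a))))
      where
      e : ∀ a d → 4 * (a * (a + d)) + d * d ≡ (a + (a + d)) * (a + (a + d))
      e = solve-∀
    ... | inj₂ b≤a = subst (λ c → 4 * (c * b) ≤ (c + b) * (c + b)) (m+[n∸m]≡n b≤a)
                          (≤-trans (m≤m+n _ _) (≤-reflexive (e b (a ∸ b))))
      where
      e : ∀ b d → 4 * ((b + d) * b) + d * d ≡ (b + d + b) * (b + d + b)
      e = solve-∀
    r : ∀ i j → 2 * (i + j) ∸ i ≡ i + j + j
    r i j = trans (cong (_∸ i) (e i j)) (m+n∸m≡n i _)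
      where
      e : ∀ i j → 2 * (i + j) ≡ i + (i + j + j)
      e = solve-∀
    go : ∀ i j → 4 * ((i + j + i) * (2 * (i + j) ∸ i)) ≤ 9 * ((i + j) * (i + j))
    go i j rewrite r i j = ≤-trans (square (i + j + i) (i + j + j)) (≤-reflexive (e i j))
      where
      e : ∀ i j → (i + j + i + (i + j + j)) * (i + j + i + (i + j + j)) ≡ 9 * ((i + j) * (i + j))
      e = solve-∀

  -- The harmonic estimate 1/w + … + 1/(2w-1) ≥ 2/3, cleared of denominators.
  harmonic-block : ∀ v P (p : ℕ → ℕ) → (∀ i → i < suc v → (suc v + i) * p i ≡ P) →
                   2 * P ≤ 3 * ∑ (suc v) p
  harmonic-block v P p eq = *-cancelˡ-≤ (3 * (w * w)) (begin
    3 * (w * w) * (2 * P)              ≤⟨ step ⟩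
    P * (4 * S)                        ≡⟨ trans (sym (*-assoc P 4 S)) (*-distribˡ-∑ (P * 4) w _) ⟩
    ∑ w (λ i → P * 4 * (2 * w ∸ i))    ≤⟨ ∑-mono-≤ w tangent ⟩
    ∑ w (λ i → 9 * (w * w) * p i)      ≡⟨ *-distribˡ-∑ (9 * (w * w)) w p ⟨
    9 * (w * w) * ∑ w p                ≡⟨ e₃ (w * w) (∑ w p) ⟩
    3 * (w * w) * (3 * ∑ w p)          ∎)
    where
    open ≤-Reasoning
    w : ℕ
    w = suc v
    S : ℕ
    S = ∑ w (λ i → 2 * w ∸ i)
    e₁ : ∀ P w → 3 * (w * w) * (2 * P) ≡ P * 2 * (3 * (w * w))
    e₁ = solve-∀
    e₂ : ∀ P S → P * 2 * (2 * S) ≡ P * (4 * S)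
    e₂ = solve-∀
    e₃ : ∀ q s → 9 * q * s ≡ 3 * q * (3 * s)
    e₃ = solve-∀
    e₄ : ∀ w → 4 * w * w ≡ 3 * (w * w) + w * w
    e₄ = solve-∀
    e₅ : ∀ a q r → a * q * 4 * r ≡ 4 * (a * r) * q
    e₅ = solve-∀
    bound : 3 * (w * w) ≤ 2 * S
    bound = +-cancelʳ-≤ (w * w) _ _ (≤-trans (≤-reflexive (sym (e₄ w))) (∑-descending w w))
    step : 3 * (w * w) * (2 * P) ≤ P * (4 * S)
    step = begin
      3 * (w * w) * (2 * P)   ≡⟨ e₁ P w ⟩
      P * 2 * (3 * (w * w))   ≤⟨ *-monoʳ-≤ (P * 2) bound ⟩
      P * 2 * (2 * S)         ≡⟨ e₂ P S ⟩
      P * (4 * S)             ∎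
    -- Divided by `9w²`, the left side is `P` times the tangent to `1/x` at `3w/2`, evaluated at
    -- `x = w + i`.
    tangent : ∀ i → i < w → P * 4 * (2 * w ∸ i) ≤ 9 * (w * w) * p i
    tangent i i<w = begin
      P * 4 * (2 * w ∸ i)                    ≡⟨ cong (λ q → q * 4 * (2 * w ∸ i)) (eq i i<w) ⟨
      (w + i) * p i * 4 * (2 * w ∸ i)        ≡⟨ e₅ (w + i) (p i) (2 * w ∸ i) ⟩
      4 * ((w + i) * (2 * w ∸ i)) * p i      ≤⟨ *-monoˡ-≤ (p i) (4x[3w∸x]≤9w² w i (<⇒≤ i<w)) ⟩
      9 * (w * w) * p i                      ∎

  indicator : ∀ {P : Set} → Dec P → ℕ
  indicator (yes _) = 1
  indicator (no _)  = 0

  indicator-true : ∀ {P : Set} (d : Dec P) → P → indicator d ≡ 1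
  indicator-true (yes _) p = refl
  indicator-true (no ¬p) p = contradiction p ¬p

  indicator-false : ∀ {P : Set} (d : Dec P) → ¬ P → indicator d ≡ 0
  indicator-false (yes p) ¬p = contradiction p ¬p
  indicator-false (no _)  ¬p = refl

  indicator-≤1 : ∀ {P : Set} (d : Dec P) → indicator d ≤ 1
  indicator-≤1 (yes _) = ≤-refl
  indicator-≤1 (no _)  = z≤n

  suc∣! : ∀ {x K} → x < K → suc x ∣ K !
  suc∣! {x} x<K = ∣-trans (m∣m*n (x !)) (m≤n⇒m!∣n! x<K)

  -- Indices are shifted by one: n z and μ x stand for the quantities at distance z + 1
  -- and x + 1 from the deadline.  The hypothesis is used only for the interval from
  -- x + 1 to 2 (x + 1), cut at K, with weight 1/(x + 1); a unit of n z then receives total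
  -- weight ∑_{z+1 ≤ 2x ≤ 2(z+1)} 1/x ≥ 2/3.
  total≤3∑density : ∀ K (n μ : ℕ → ℕ) →
    (∀ x j → suc x + j ≤ K → ∑ (suc j) (λ i → n (x + i)) ≤ μ x * (suc x + j)) →
    ∑ K n ≤ 3 * ∑ K μ
  total≤3∑density K n μ dense = *-cancelˡ-≤ (2 * P) {{m*n≢0 2 P {{_}} {{K !≢0}}}} (begin
    2 * P * ∑ K n                                       ≡⟨ *-distribˡ-∑ (2 * P) K n ⟩
    ∑ K (λ z → 2 * P * n z)                             ≤⟨ ∑-mono-≤ K covered ⟩
    ∑ K (λ z → ∑ K (λ x → 3 * p x * (I x z * n z)))     ≡⟨ ∑-swap K K (λ z x → 3 * p x * (I x z * n z)) ⟩
    ∑ K (λ x → ∑ K (λ z → 3 * p x * (I x z * n z)))     ≡⟨ ∑-cong K (λ x _ → sym (*-distribˡ-∑ (3 * p x) K _)) ⟩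
    ∑ K (λ x → 3 * p x * ∑ K (λ z → I x z * n z))       ≤⟨ ∑-mono-≤ K paid ⟩
    ∑ K (λ x → 2 * P * 3 * μ x)                         ≡⟨ *-distribˡ-∑ (2 * P * 3) K μ ⟨
    2 * P * 3 * ∑ K μ                                   ≡⟨ *-assoc (2 * P) 3 _ ⟩
    2 * P * (3 * ∑ K μ)                                 ∎)
    where
    open ≤-Reasoning
    -- `K !` is divisible by every `suc x` with `x < K`, so `p x` is exactly `K ! / (x + 1)` and all
    -- weights become natural numbers.
    P : ℕ
    P = K !
    p : ℕ → ℕ
    p x = P / suc x
    p-spec : ∀ x → x < K → suc x * p x ≡ P
    p-spec x x<K = m*[n/m]≡n (suc∣! x<K)
    I? : ∀ x z → Dec (x ≤ z × z ≤ suc (x + x))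
    I? x z = (x ≤? z) ×-dec (z ≤? suc (x + x))
    I : ℕ → ℕ → ℕ
    I x z = indicator (I? x z)

    covered : ∀ z → z < K → 2 * P * n z ≤ ∑ K (λ x → 3 * p x * (I x z * n z))
    covered z z<K = begin
      2 * P * n z                                     ≤⟨ *-monoˡ-≤ (n z) (harmonic-block v P (λ i → p (v + i)) (λ i i<w → p-spec (v + i) (v+i<K i i<w))) ⟩
      3 * ∑ w (λ i → p (v + i)) * n z                 ≡⟨ cong (λ s → 3 * s * n z) (∑-cong w chosen) ⟩
      3 * ∑ w (λ i → I (v + i) z * p (v + i)) * n z   ≤⟨ *-monoˡ-≤ (n z) (*-monoʳ-≤ 3 (∑-shift-≤ v w (λ x → I x z * p x) v+w≤K)) ⟩
      3 * ∑ K (λ x → I x z * p x) * n z               ≡⟨ e₁ _ (n z) ⟩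
      3 * n z * ∑ K (λ x → I x z * p x)               ≡⟨ *-distribˡ-∑ (3 * n z) K _ ⟩
      ∑ K (λ x → 3 * n z * (I x z * p x))             ≡⟨ ∑-cong K (λ x _ → e₂ (n z) (I x z) (p x)) ⟩
      ∑ K (λ x → 3 * p x * (I x z * n z))             ∎
      where
      -- The indices `v, …, 2v` all satisfy the condition of `I?`, with denominators `w, …, 2w - 1`
      -- as in `harmonic-block`. For odd `z` the index `2v + 1` qualifies too, but its weight is
      -- given away.
      v w : ℕ
      v = z / 2
      w = suc v
      2v≤z : v + v ≤ z
      2v≤z = ≤-trans (≤-reflexive (e v)) (m/n*n≤m z 2)
        where
        e : ∀ v → v + v ≡ v * 2
        e = solve-∀
      z≤2v+1 : z ≤ suc (v + v)
      z≤2v+1 = begin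
        z                ≡⟨ m≡m%n+[m/n]*n z 2 ⟩
        z % 2 + v * 2    ≤⟨ +-monoˡ-≤ (v * 2) (s≤s⁻¹ (m%n<n z 2)) ⟩
        1 + v * 2        ≡⟨ e v ⟩
        suc (v + v)      ∎
        where
        e : ∀ v → 1 + v * 2 ≡ suc (v + v)
        e = solve-∀
      v+w≤K : v + w ≤ K
      v+w≤K = ≤-trans (≤-reflexive (+-suc v v)) (≤-trans (s≤s 2v≤z) z<K)
      v+i<K : ∀ i → i < w → v + i < K
      v+i<K i i<w = ≤-trans (+-monoʳ-< v i<w) v+w≤K
      chosen : ∀ i → i < w → p (v + i) ≡ I (v + i) z * p (v + i)
      chosen i i<w = sym (trans (cong (_* p (v + i)) (indicator-true (I? (v + i) z)
        ( ≤-trans (+-monoʳ-≤ v (s≤s⁻¹ i<w)) 2v≤z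
        , ≤-trans z≤2v+1 (s≤s (+-mono-≤ (m≤m+n v i) (m≤m+n v i))))))
        (*-identityˡ _))
      e₁ : ∀ a b → 3 * a * b ≡ 3 * b * a
      e₁ = solve-∀
      e₂ : ∀ a b c → 3 * a * (b * c) ≡ 3 * c * (b * a)
      e₂ = solve-∀

    interval≤ : ∀ x → x < K → ∑ K (λ z → I x z * n z) ≤ μ x * (2 * suc x)
    interval≤ x x<K = begin
      ∑ K (λ z → I x z * n z)                      ≤⟨ ∑-restrict-≤ x (suc j) (λ z → I x z * n z) fits below above ⟩
      ∑ (suc j) (λ i → I x (x + i) * n (x + i))    ≤⟨ ∑-mono-≤ (suc j) (λ i _ → ≤-trans (*-monoˡ-≤ (n (x + i)) (indicator-≤1 (I? x (x + i)))) (≤-reflexive (*-identityˡ _))) ⟩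
      ∑ (suc j) (λ i → n (x + i))                  ≤⟨ dense x j (≤-trans (≤-reflexive (sym (+-suc x j))) fits) ⟩
      μ x * (suc x + j)                            ≤⟨ *-monoʳ-≤ (μ x) (+-monoʳ-≤ (suc x) (≤-trans (m⊓n≤m (suc x) _) (m≤m+n (suc x) 0))) ⟩
      μ x * (2 * suc x)                            ∎
      where
      -- The indices below `K` allowed by `I?` are `x, …, x + j`: they end at `2x + 1`, or at
      -- `K - 1` if the cut comes first.
      j : ℕ
      j = suc x ⊓ (K ∸ suc x)
      fits : x + suc j ≤ K
      fits = begin
        x + suc j                 ≡⟨ +-suc x j ⟩
        suc x + j                 ≤⟨ +-monoʳ-≤ (suc x) (m⊓n≤n (suc x) _) ⟩
        suc x + (K ∸ suc x)       ≡⟨ m+[n∸m]≡n x<K ⟩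
        K                         ∎
      below : ∀ z → z < x → I x z * n z ≡ 0
      below z z<x = cong (_* n z) (indicator-false (I? x z) (λ q → <⇒≱ z<x (proj₁ q)))
      above : ∀ z → z < K → x + suc j ≤ z → I x z * n z ≡ 0
      above z z<K x+sj≤z = cong (_* n z) (indicator-false (I? x z) (λ q → absurd (proj₂ q)))
        where
        absurd : z ≤ suc (x + x) → _
        absurd z≤ with ⊓-sel (suc x) (K ∸ suc x)
        ... | inj₁ eq = <⇒≱ (begin-strict
                suc (x + x)        <⟨ ≤-refl ⟩
                suc (suc (x + x))  ≡⟨ cong suc (+-suc x x) ⟨
                suc (x + suc x)    ≡⟨ +-suc x (suc x) ⟨
                x + suc (suc x)    ≡⟨ cong (λ j → x + suc j) eq ⟨
                x + suc j          ≤⟨ x+sj≤z ⟩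
                z                  ∎) z≤
        ... | inj₂ eq = <⇒≱ z<K (begin
                K                     ≡⟨ m+[n∸m]≡n x<K ⟨
                suc x + (K ∸ suc x)   ≡⟨ cong (suc x +_) eq ⟨
                suc x + j             ≡⟨ +-suc x j ⟨
                x + suc j             ≤⟨ x+sj≤z ⟩
                z                     ∎)

    paid : ∀ x → x < K → 3 * p x * ∑ K (λ z → I x z * n z) ≤ 2 * P * 3 * μ x
    paid x x<K = begin
      3 * p x * ∑ K (λ z → I x z * n z)   ≤⟨ *-monoʳ-≤ (3 * p x) (interval≤ x x<K) ⟩
      3 * p x * (μ x * (2 * suc x))       ≡⟨ e (p x) (μ x) (suc x) ⟩
      2 * (suc x * p x) * 3 * μ x         ≡⟨ cong (λ q → 2 * q * 3 * μ x) (p-spec x x<K) ⟩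
      2 * P * 3 * μ x                     ∎
      where
      e : ∀ a b c → 3 * a * (b * (2 * c)) ≡ 2 * (c * a) * 3 * b
      e = solve-∀

  -- Finite maxima and rounded-up quotients.

  maxBelow : ℕ → (ℕ → ℕ) → ℕ
  maxBelow zero    f = 0
  maxBelow (suc n) f = maxBelow n f ⊔ f n

  maxBelow-cong : ∀ n {f g} → (∀ i → i < n → f i ≡ g i) → maxBelow n f ≡ maxBelow n g
  maxBelow-cong zero    eq = refl
  maxBelow-cong (suc n) eq = cong₂ _⊔_ (maxBelow-cong n λ i i<n → eq i (m<n⇒m<1+n i<n)) (eq n ≤-refl)

  ≤-maxBelow : ∀ n f i → i < n → f i ≤ maxBelow n f
  ≤-maxBelow (suc n) f i i<1+n with m≤n⇒m<n∨m≡n (s≤s⁻¹ i<1+n)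
  ... | inj₁ i<n  = m≤n⇒m≤n⊔o (f n) (≤-maxBelow n f i i<n)
  ... | inj₂ refl = m≤n⊔m (maxBelow n f) (f n)

  maxBelow-≤ : ∀ n f {B} → (∀ i → i < n → f i ≤ B) → maxBelow n f ≤ B
  maxBelow-≤ zero    f le = z≤n
  maxBelow-≤ (suc n) f le = ⊔-lub (maxBelow-≤ n f λ i i<n → le i (m<n⇒m<1+n i<n)) (le n ≤-refl)

  -- This is ⌈c/(l+1)⌉; shifting the divisor by one keeps it nonzero.
  ceilDiv : ℕ → ℕ → ℕ
  ceilDiv c l = (c + l) / suc l

  ≤-ceilDiv : ∀ c l → c ≤ ceilDiv c l * suc l
  ≤-ceilDiv c l = +-cancelˡ-≤ l _ _ (begin
    l + c                                         ≡⟨ +-comm l c ⟩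
    c + l                                         ≡⟨ m≡m%n+[m/n]*n (c + l) (suc l) ⟩
    (c + l) % suc l + ceilDiv c l * suc l         ≤⟨ +-monoˡ-≤ _ (s≤s⁻¹ (m%n<n (c + l) (suc l))) ⟩
    l + ceilDiv c l * suc l                       ∎)
    where open ≤-Reasoning

  ceilDiv-≤ : ∀ c l {X} → c ≤ X * suc l → ceilDiv c l ≤ X
  ceilDiv-≤ c l {X} c≤ = s≤s⁻¹ (m<n*o⇒m/o<n {n = suc X} (begin-strict
    c + l              <⟨ +-mono-≤-< c≤ (n<1+n l) ⟩
    X * suc l + suc l  ≡⟨ +-comm (X * suc l) (suc l) ⟩
    suc X * suc l      ∎))
    where open ≤-Reasoning

  -- Tasks and earliest-deadline order.

  -- A job as seen inside a block: its deadline relative to the block, and its name.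
  Task : Set
  Task = ℕ × JobId

  Arrivals : Set
  Arrivals = ℕ → List Task

  due : ℕ → List Task → ℕ
  due D ts = length (filter (λ j → proj₁ j ≤? D) ts)

  due-++ : ∀ D xs ys → due D (xs ++ ys) ≡ due D xs + due D ys
  due-++ D xs ys = trans (cong length (filter-++ (λ j → proj₁ j ≤? D) xs ys)) (length-++ (filter (λ j → proj₁ j ≤? D) xs))

  due-↭ : ∀ D {xs ys} → xs ↭ ys → due D xs ≡ due D ys
  due-↭ D xs↭ys = ↭-length (filter-↭ (λ j → proj₁ j ≤? D) xs↭ys)

  ∈⇒due>0 : ∀ {D j xs} → j ∈ xs → proj₁ j ≤ D → 0 < due D xs
  ∈⇒due>0 {D} j∈ le = ∈-length (∈-filter⁺ (λ j → proj₁ j ≤? D) j∈ le)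

  open Sort (On.decTotalOrder ≤-decTotalOrder (proj₁ {A = ℕ} {B = λ _ → JobId})) using (sort; sort-↭; sort-↗)

  EarliestFirst : List Task → Set
  EarliestFirst = AllPairs (λ i j → proj₁ i ≤ proj₁ j)

  sort-earliestFirst : ∀ xs → EarliestFirst (sort xs)
  sort-earliestFirst xs = Linked⇒AllPairs ≤-trans (sort-↗ xs)

  -- In a list sorted by deadline the tasks due by `D` form a prefix, so dropping from the front
  -- removes these first.
  due-drop : ∀ D M {xs} → EarliestFirst xs → due D (drop M xs) ≡ due D xs ∸ M
  due-drop D zero    _  = refl
  due-drop D (suc M) [] = refl
  due-drop D (suc M) {x ∷ xs} (x≤ ∷ sorted) with proj₁ x ≤? D
  ... | yes x≤D = trans (due-drop D M sorted) (cong (λ ys → length ys ∸ suc M) (sym (filter-accept (λ j → proj₁ j ≤? D) x≤D)))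
  ... | no  x≰D = trans (due-drop D M sorted) (trans (cong (_∸ M) none)
                   (trans (0∸n≡0 M) (sym (trans (cong (λ ys → length ys ∸ suc M) (filter-reject (λ j → proj₁ j ≤? D) x≰D))
                     (cong (_∸ suc M) none)))))
    where
    none : due D xs ≡ 0
    none = cong length (filter-none (λ j → proj₁ j ≤? D) (All.map (λ x≤j j≤D → x≰D (≤-trans x≤j j≤D)) x≤))

  -- Pairing tasks with machines.

  private variable
    A B : Set

  ∈-zip⁻ : ∀ (xs : List A) (ys : List B) {p} → p ∈ zip xs ys → proj₁ p ∈ xs × proj₂ p ∈ ys
  ∈-zip⁻ (x ∷ xs) (y ∷ ys) (here refl) = here refl , here refl
  ∈-zip⁻ (x ∷ xs) (y ∷ ys) (there p∈)  = let l , r = ∈-zip⁻ xs ys p∈ in there l , there r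

  map-proj₂-zip : ∀ (xs : List A) (ys : List B) → map proj₂ (zip xs ys) ≡ take (length xs) ys
  map-proj₂-zip []       ys       = refl
  map-proj₂-zip (x ∷ xs) []       = refl
  map-proj₂-zip (x ∷ xs) (y ∷ ys) = cong (y ∷_) (map-proj₂-zip xs ys)

  -- Since `zip` stops at the shorter list, a task left without a machine is one that `drop` carries
  -- over to the next slot.
  ∈-zip⊎drop : ∀ {x : A} (xs : List A) (ys : List B) → x ∈ xs →
               (∃ λ y → (x , y) ∈ zip xs ys) ⊎ x ∈ drop (length ys) xs
  ∈-zip⊎drop xs       []       x∈          = inj₂ x∈
  ∈-zip⊎drop (x ∷ xs) (y ∷ ys) (here refl) = inj₁ (y , here refl)
  ∈-zip⊎drop (x ∷ xs) (y ∷ ys) (there x∈) with ∈-zip⊎drop xs ys x∈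
  ... | inj₁ (y′ , p∈) = inj₁ (y′ , there p∈)
  ... | inj₂ x∈drop    = inj₂ x∈drop

  ∈-drop⁻ : ∀ n {x : A} {xs} → x ∈ drop n xs → x ∈ xs
  ∈-drop⁻ zero                  x∈ = x∈
  ∈-drop⁻ (suc n) {xs = _ ∷ xs} x∈ = there (∈-drop⁻ n x∈)

  -- Links the two ways of counting arrivals: backwards by distance from a deadline, and forwards in
  -- time.
  ∑-reverse : ∀ f u n → n ≤ suc u → ∑ n (λ i → f (u ∸ i)) + ∑ (suc u ∸ n) f ≡ ∑ (suc u) f
  ∑-reverse f u zero    _    = refl
  ∑-reverse f u (suc n) n≤u = begin
    ∑ n (λ i → f (u ∸ i)) + f (u ∸ n) + ∑ (u ∸ n) f      ≡⟨ e (∑ n (λ i → f (u ∸ i))) (f (u ∸ n)) _ ⟩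
    ∑ n (λ i → f (u ∸ i)) + ∑ (suc (u ∸ n)) f            ≡⟨ cong (λ k → ∑ n (λ i → f (u ∸ i)) + ∑ k f) (+-∸-assoc 1 (s≤s⁻¹ n≤u)) ⟨
    ∑ n (λ i → f (u ∸ i)) + ∑ (suc u ∸ n) f              ≡⟨ ∑-reverse f u n (<⇒≤ n≤u) ⟩
    ∑ (suc u) f                                          ∎
    where
    open ≡-Reasoning
    e : ∀ a b c → a + b + c ≡ a + (c + b)
    e = solve-∀

  -- Earliest deadline first within one block.

  module EDF (T : ℕ) where

    -- A difference of prefix sums: for `b ≤ x` it counts the tasks released at `b, …, x` and due by
    -- `D`, all of them known at time `x`.
    released : Arrivals → (D b x : ℕ) → ℕ
    released a D b x = ∑ (suc x) (λ y → due D (a y)) ∸ ∑ b (λ y → due D (a y))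

    -- The maximum runs over windows `[b, b + l + 1)` of length at most `T`; the quotient is the
    -- number of machines needed to process inside the window the tasks counted for it.
    density : Arrivals → ℕ → ℕ
    density a x = maxBelow (suc x) λ b → maxBelow T λ l → ceilDiv (released a (b + suc l) b x) l

    cap : Arrivals → ℕ → ℕ
    cap a x = 3 * density a x

    mutual
      -- An expired task would not be discarded here; that deadlines are met is the later statement
      -- `no-late` about this list.
      backlog : Arrivals → ℕ → List Task
      backlog a zero    = []
      backlog a (suc x) = drop (cap a x) (queue a x)

      queue : Arrivals → ℕ → List Task
      queue a x = sort (backlog a x ++ a x)

    -- Machines opened earlier remain in use until the block ends, so only the increase of `cap` has
    -- to be opened.
    opened : Arrivals → ℕ → ℕ
    opened a zero    = cap a zero
    opened a (suc x) = cap a (suc x) ∸ cap a x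

    batch : ℕ → ℕ → List CalId
    batch u n = map (u ,_) (upTo n)

    machines : ℕ → Arrivals → ℕ → List CalId
    machines s a zero    = batch (s + zero) (opened a zero)
    machines s a (suc x) = machines s a x ++ batch (s + suc x) (opened a (suc x))

    served : ℕ → Arrivals → ℕ → List (Task × CalId)
    served s a x = zip (queue a x) (machines s a x)

    -- The congruences that follow make the algorithm online: its state at `x` depends only on the
    -- arrivals up to `x`.
    AgreeUpTo : ℕ → Arrivals → Arrivals → Set
    AgreeUpTo x a a′ = ∀ y → y ≤ x → a y ≡ a′ y

    module _ {a a′ : Arrivals} where

      weaken : ∀ {x} → AgreeUpTo (suc x) a a′ → AgreeUpTo x a a′
      weaken eq y y≤x = eq y (m≤n⇒m≤1+n y≤x)

      density-cong : ∀ x → AgreeUpTo x a a′ → density a x ≡ density a′ x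
      density-cong x eq = maxBelow-cong (suc x) λ b b≤x → maxBelow-cong T λ l _ →
        cong (λ c → ceilDiv c l) (cong₂ _∸_ (sums (b + suc l) (suc x) ≤-refl) (sums (b + suc l) b (<⇒≤ b≤x)))
        where
        sums : ∀ D v → v ≤ suc x → ∑ v (λ y → due D (a y)) ≡ ∑ v (λ y → due D (a′ y))
        sums D v v≤ = ∑-cong v λ y y<v → cong (due D) (eq y (s≤s⁻¹ (≤-trans y<v v≤)))

      cap-cong : ∀ x → AgreeUpTo x a a′ → cap a x ≡ cap a′ x
      cap-cong x eq = cong (3 *_) (density-cong x eq)

      queue-cong : ∀ x → AgreeUpTo x a a′ → queue a x ≡ queue a′ x
      queue-cong zero    eq = cong sort (eq 0 z≤n)
      queue-cong (suc x) eq = cong₂ (λ l r → sort (l ++ r))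
        (cong₂ drop (cap-cong x (weaken eq)) (queue-cong x (weaken eq))) (eq (suc x) ≤-refl)

      opened-cong : ∀ x → AgreeUpTo x a a′ → opened a x ≡ opened a′ x
      opened-cong zero    eq = cap-cong zero eq
      opened-cong (suc x) eq = cong₂ _∸_ (cap-cong (suc x) eq) (cap-cong x (weaken eq))

      machines-cong : ∀ s x → AgreeUpTo x a a′ → machines s a x ≡ machines s a′ x
      machines-cong s zero    eq = cong (batch _) (opened-cong zero eq)
      machines-cong s (suc x) eq = cong₂ _++_ (machines-cong s x (weaken eq)) (cong (batch _) (opened-cong (suc x) eq))

      served-cong : ∀ s x → AgreeUpTo x a a′ → served s a x ≡ served s a′ x
      served-cong s x eq = cong₂ zip (queue-cong x eq) (machines-cong s x eq)

    released≤density : ∀ a x b l → b ≤ x → l < T → released a (b + suc l) b x ≤ density a x * suc l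
    released≤density a x b l b≤x l<T = ≤-trans (≤-ceilDiv _ l) (*-monoˡ-≤ (suc l)
      (≤-trans (≤-maxBelow T (λ l → ceilDiv (released a (b + suc l) b x) l) l l<T)
               (≤-maxBelow (suc x) (λ b → maxBelow T λ l → ceilDiv (released a (b + suc l) b x) l) b (s≤s b≤x))))

    density-≤ : ∀ a x {X} → (∀ b l → b ≤ x → l < T → released a (b + suc l) b x ≤ X * suc l) → density a x ≤ X
    density-≤ a x le = maxBelow-≤ (suc x) _ λ b b≤x → maxBelow-≤ T _ λ l l<T → ceilDiv-≤ _ l (le b l (s≤s⁻¹ b≤x) l<T)

    density-mono : ∀ a x → density a x ≤ density a (suc x)
    density-mono a x = maxBelow-≤ (suc x) _ λ b b≤x → maxBelow-≤ T _ λ l l<T → ceilDiv-≤ _ l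
      (≤-trans (∸-monoˡ-≤ (∑ b (λ y → due (b + suc l) (a y))) (m≤m+n _ (due (b + suc l) (a (suc x)))))
               (released≤density a (suc x) b l (<⇒≤ b≤x) l<T))

    -- Once arrivals stop the density is frozen.
    opened≡0 : ∀ a x → a (suc x) ≡ [] → opened a (suc x) ≡ 0
    opened≡0 a x stop = m≤n⇒m∸n≡0 (*-monoʳ-≤ 3 (density-≤ a (suc x) {density a x} step))
      where
      unchanged : ∀ D → ∑ (suc (suc x)) (λ y → due D (a y)) ≡ ∑ (suc x) (λ y → due D (a y))
      unchanged D = trans (cong (λ ts → ∑ (suc x) (λ y → due D (a y)) + due D ts) stop) (+-identityʳ _)
      step : ∀ b l → b ≤ suc x → l < T → released a (b + suc l) b (suc x) ≤ density a x * suc l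
      step b l b≤ l<T with m≤n⇒m<n∨m≡n b≤
      ... | inj₁ b≤x  = ≤-trans (≤-reflexive (cong (_∸ ∑ b (λ y → due (b + suc l) (a y))) (unchanged (b + suc l))))
                                (released≤density a x b l (s≤s⁻¹ b≤x) l<T)
      -- The only new left endpoint is `suc x`, and its count concerns just the empty arrivals at
      -- `suc x`.
      ... | inj₂ refl = ≤-trans (≤-reflexive (trans (cong (_∸ ∑ b (λ y → due (b + suc l) (a y))) (unchanged (b + suc l)))
                                                    (n∸n≡0 (∑ b (λ y → due (b + suc l) (a y)))))) z≤n

    -- The sum telescopes: the density never decreases, so the truncated differences in `opened` are
    -- true differences.
    ∑opened : ∀ a x → ∑ (suc x) (opened a) ≡ cap a x
    ∑opened a zero    = refl
    ∑opened a (suc x) = trans (cong (_+ opened a (suc x)) (∑opened a x)) (m+[n∸m]≡n (*-monoʳ-≤ 3 (density-mono a x)))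

    length-machines : ∀ s a x → length (machines s a x) ≡ ∑ (suc x) (opened a)
    length-machines s a zero    = trans (length-map _ (upTo (opened a 0))) (length-upTo _)
    length-machines s a (suc x) = trans (length-++ (machines s a x))
      (cong₂ _+_ (length-machines s a x) (trans (length-map _ (upTo (opened a (suc x)))) (length-upTo _)))

    ∈-batch⁻ : ∀ {u n c} → c ∈ batch u n → proj₁ c ≡ u × proj₂ c < n
    ∈-batch⁻ {u} c∈ with ∈-map⁻ (u ,_) c∈
    ... | k , k∈ , refl = refl , ∈-upTo⁻ k∈

    ∈-machines⁻ : ∀ s a x {c} → c ∈ machines s a x →
                  ∃ λ y → y ≤ x × proj₁ c ≡ s + y × proj₂ c < opened a y
    ∈-machines⁻ s a zero    c∈ = 0 , z≤n , ∈-batch⁻ c∈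
    ∈-machines⁻ s a (suc x) c∈ with ∈-++⁻ (machines s a x) c∈
    ... | inj₁ c∈old = let y , y≤x , r = ∈-machines⁻ s a x c∈old in y , m≤n⇒m≤1+n y≤x , r
    ... | inj₂ c∈new = suc x , ≤-refl , ∈-batch⁻ c∈new

    machines-unique : ∀ s a x → Unique (machines s a x)
    machines-unique s a zero    = Unique.map⁺ (cong proj₂) (Unique.upTo⁺ _)
    machines-unique s a (suc x) = Unique.++⁺ (machines-unique s a x) (Unique.map⁺ (cong proj₂) (Unique.upTo⁺ _)) disjoint
      where
      disjoint : ∀ {c} → ¬ (c ∈ machines s a x × c ∈ batch (s + suc x) (opened a (suc x)))
      disjoint (old , new) with ∈-machines⁻ s a x old
      ... | y , y≤x , u≡ , _ = <⇒≢ (s≤s y≤x) (+-cancelˡ-≡ s _ _ (trans (sym u≡) (proj₁ (∈-batch⁻ new))))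

    due-backlog : ∀ D a x → due D (backlog a (suc x)) ≡ due D (backlog a x) + due D (a x) ∸ cap a x
    due-backlog D a x = trans (due-drop D (cap a x) (sort-earliestFirst (backlog a x ++ a x)))
      (cong (_∸ cap a x) (trans (due-↭ D (sort-↭ (backlog a x ++ a x))) (due-++ D (backlog a x) (a x))))

    -- Index `x` is the slot at distance `x + 1` before `D`. The density at that slot dominates
    -- every window ending at `D`, with releases counted up to the slot, which is the hypothesis of
    -- `total≤3∑density`. The condition `D ≤ T` keeps these windows within the lengths that
    -- `density` inspects.
    demand≤capacity : ∀ a D z → D ≤ T → z ≤ D →
      ∑ z (λ x → due D (a (D ∸ suc x))) ≤ ∑ z (λ x → cap a (D ∸ suc x))
    demand≤capacity a D z D≤T z≤D = ≤-trans
      (total≤3∑density z _ (λ x → density a (D ∸ suc x)) dense)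
      (≤-reflexive (*-distribˡ-∑ 3 z _))
      where
      open ≤-Reasoning
      f : ℕ → ℕ
      f y = due D (a y)
      dense : ∀ x j → suc x + j ≤ z → ∑ (suc j) (λ i → f (D ∸ suc (x + i))) ≤ density a (D ∸ suc x) * (suc x + j)
      dense x j fits = begin
        ∑ (suc j) (λ i → f (D ∸ suc (x + i)))     ≡⟨ ∑-cong (suc j) (λ i _ → cong f (sym (∸-+-assoc D (suc x) i))) ⟩
        ∑ (suc j) (λ i → f (u ∸ i))               ≡⟨ m+n∸n≡m _ (∑ (u ∸ j) f) ⟨
        ∑ (suc j) (λ i → f (u ∸ i)) + ∑ (u ∸ j) f ∸ ∑ (u ∸ j) f
                                                  ≡⟨ cong (_∸ ∑ (u ∸ j) f) (∑-reverse f u (suc j) (s≤s j≤u)) ⟩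
        ∑ (suc u) f ∸ ∑ (u ∸ j) f                 ≡⟨ cong (λ b → ∑ (suc u) f ∸ ∑ b f) (∸-+-assoc D (suc x) j) ⟩
        released a D b u                          ≡⟨ cong (λ D → released a D b u) (sym (m∸n+n≡m l≤D)) ⟩
        released a (b + suc (x + j)) b u          ≤⟨ released≤density a u b (x + j) (∸-monoʳ-≤ D (m≤m+n (suc x) j)) (≤-trans l≤D D≤T) ⟩
        density a u * suc (x + j)                 ∎
        where
        u b : ℕ
        u = D ∸ suc x
        b = D ∸ (suc x + j)
        l≤D : suc x + j ≤ D
        l≤D = ≤-trans fits z≤D
        j≤u : j ≤ u
        j≤u = ≤-trans (≤-reflexive (sym (m+n∸m≡n (suc x) j))) (∸-monoˡ-≤ (suc x) l≤D)

    -- Lindley's recursion: t slots have elapsed and z remain before D.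
    backlog-bound : ∀ a D → D ≤ T → ∀ t z → t + z ≡ D →
      due D (backlog a t) + ∑ z (λ x → due D (a (D ∸ suc x))) ≤ ∑ z (λ x → cap a (D ∸ suc x))
    backlog-bound a D D≤T zero    z eq = demand≤capacity a D z D≤T (≤-reflexive eq)
    backlog-bound a D D≤T (suc t) z eq rewrite due-backlog D a t = go (≤-total (Bt + At) (cap a t))
      where
      open ≤-Reasoning
      Bt At N M : ℕ
      Bt = due D (backlog a t)
      At = due D (a t)
      N = ∑ z (λ x → due D (a (D ∸ suc x)))
      M = ∑ z (λ x → cap a (D ∸ suc x))
      t≡ : D ∸ suc z ≡ t
      t≡ = trans (cong (_∸ suc z) (trans (sym eq) (sym (+-suc t z)))) (m+n∸n≡m t (suc z))
      before : Bt + (N + At) ≤ M + cap a t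
      before = subst (λ s → Bt + (N + due D (a s)) ≤ M + cap a s) t≡
                 (backlog-bound a D D≤T t (suc z) (trans (+-suc t z) eq))
      go : Bt + At ≤ cap a t ⊎ cap a t ≤ Bt + At → Bt + At ∸ cap a t + N ≤ M
      -- If the slot clears all tasks due by `D`, only future arrivals count and `demand≤capacity`
      -- applies afresh. Otherwise every machine runs a task due by `D`, and `cap a t` cancels on
      -- both sides.
      go (inj₁ le) rewrite m≤n⇒m∸n≡0 le = demand≤capacity a D z D≤T (≤-trans (m≤n+m z (suc t)) (≤-reflexive eq))
      go (inj₂ ge) = +-cancelʳ-≤ (cap a t) _ _ (begin
        Bt + At ∸ cap a t + N + cap a t     ≡⟨ e₁ (Bt + At ∸ cap a t) N (cap a t) ⟩
        Bt + At ∸ cap a t + cap a t + N     ≡⟨ cong (_+ N) (m∸n+n≡m ge) ⟩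
        Bt + At + N                         ≡⟨ e₂ Bt At N ⟩
        Bt + (N + At)                       ≤⟨ before ⟩
        M + cap a t                         ∎)
        where
        e₁ : ∀ a b c → a + b + c ≡ a + c + b
        e₁ = solve-∀
        e₂ : ∀ a b c → a + b + c ≡ a + (c + b)
        e₂ = solve-∀

    -- With no slot left before `D`, the capacity side of `backlog-bound` is an empty sum.
    no-late : ∀ a D → D ≤ T → due D (backlog a D) ≡ 0
    no-late a D D≤T = n≤0⇒n≡0 (≤-trans (m≤m+n _ 0) (backlog-bound a D D≤T D 0 (+-identityʳ D)))

    ∈-queue⁻ : ∀ a x {j} → j ∈ queue a x → j ∈ backlog a x ⊎ j ∈ a x
    ∈-queue⁻ a x j∈ = ∈-++⁻ (backlog a x) (∈-resp-↭ (sort-↭ (backlog a x ++ a x)) j∈)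

    ∈-queue⁺ : ∀ a x {j} → j ∈ backlog a x ⊎ j ∈ a x → j ∈ queue a x
    ∈-queue⁺ a x (inj₁ j∈) = ∈-resp-↭ (↭-sym (sort-↭ (backlog a x ++ a x))) (∈-++⁺ˡ j∈)
    ∈-queue⁺ a x (inj₂ j∈) = ∈-resp-↭ (↭-sym (sort-↭ (backlog a x ++ a x))) (∈-++⁺ʳ (backlog a x) j∈)

    queue-origin : ∀ a x {j} → j ∈ queue a x → ∃ λ y → y ≤ x × j ∈ a y
    queue-origin a x j∈ with ∈-queue⁻ a x j∈
    queue-origin a x       j∈ | inj₂ j∈a  = x , ≤-refl , j∈a
    queue-origin a (suc x) j∈ | inj₁ j∈bl =
      let y , y≤x , j∈a = queue-origin a x (∈-drop⁻ (cap a x) j∈bl) in y , m≤n⇒m≤1+n y≤x , j∈a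

    Admissible : Arrivals → Set
    Admissible a = ∀ x {j} → j ∈ a x → x < proj₁ j × proj₁ j ≤ T

    module _ {a : Arrivals} (adm : Admissible a) where

      -- A carried-over task that has expired at `suc x` would be a task due by `suc x` in the
      -- backlog at `suc x`, against `no-late`.
      queue-deadline : ∀ x {j} → j ∈ queue a x → x < proj₁ j × proj₁ j ≤ T
      queue-deadline x j∈ with ∈-queue⁻ a x j∈
      queue-deadline x           j∈ | inj₂ j∈a  = adm x j∈a
      queue-deadline (suc x) {j} j∈ | inj₁ j∈bl with queue-deadline x (∈-drop⁻ (cap a x) j∈bl) | suc x <? proj₁ j
      ... | x<d , d≤T | yes 1+x<d = 1+x<d , d≤T
      ... | x<d , d≤T | no  1+x≮d = contradiction (no-late a (suc x) (≤-trans x<d d≤T)) (>⇒≢ (∈⇒due>0 j∈bl (≮⇒≥ 1+x≮d)))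

      -- The task is followed from slot to slot: each time it is run or carried over, and at its own
      -- deadline the backlog can no longer contain it.
      eventually-served : ∀ s y {j} → j ∈ a y → ∃ λ x → ∃ λ c → (j , c) ∈ served s a x
      eventually-served s y {j} j∈ with follow (proj₁ j ∸ suc y)
        where
        handle : ∀ x → j ∈ queue a x → (∃ λ x → ∃ λ c → (j , c) ∈ served s a x) ⊎ j ∈ backlog a (suc x)
        handle x j∈q with ∈-zip⊎drop (queue a x) (machines s a x) j∈q
        ... | inj₁ (c , p∈) = inj₁ (x , c , p∈)
        ... | inj₂ j∈drop   = inj₂ (subst (λ n → j ∈ drop n (queue a x)) (trans (length-machines s a x) (∑opened a x)) j∈drop)
        follow : ∀ n → (∃ λ x → ∃ λ c → (j , c) ∈ served s a x) ⊎ j ∈ backlog a (suc y + n)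
        follow zero rewrite +-identityʳ y = handle y (∈-queue⁺ a y (inj₂ j∈))
        follow (suc n) rewrite +-suc y n with follow n
        ... | inj₁ done = inj₁ done
        ... | inj₂ j∈bl = handle (suc (y + n)) (∈-queue⁺ a _ (inj₁ j∈bl))
      ... | inj₁ done = done
      ... | inj₂ j∈bl = contradiction (no-late a (proj₁ j) (proj₂ (adm y j∈)))
            (>⇒≢ (∈⇒due>0 (subst (λ t → j ∈ backlog a t) (m+[n∸m]≡n (proj₁ (adm y j∈))) j∈bl) ≤-refl))

  -- Division with remainder, guarded lists and padded histories.

  [mn+o]/n≡m : ∀ m {n o} .{{_ : NonZero n}} → o < n → (m * n + o) / n ≡ m
  [mn+o]/n≡m m {n} {o} o<n = trans (+-distrib-/-∣ˡ {m * n} o (divides m refl))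
    (trans (cong₂ _+_ (m*n/n≡m m n) (m<n⇒m/n≡0 o<n)) (+-identityʳ m))

  [mn+o]%n≡o : ∀ m {n o} .{{_ : NonZero n}} → o < n → (m * n + o) % n ≡ o
  [mn+o]%n≡o m {n} {o} o<n = trans (cong (_% n) (+-comm (m * n) o)) (trans ([m+kn]%n≡m%n o m n) (m<n⇒m%n≡m o<n))

  [m/n]n+m%n≡m : ∀ m n .{{_ : NonZero n}} → m / n * n + m % n ≡ m
  [m/n]n+m%n≡m m n = trans (+-comm (m / n * n) (m % n)) (sym (m≡m%n+[m/n]*n m n))

  keep : {P : Set} → Dec P → List A → List A
  keep (yes _) xs = xs
  keep (no _)  xs = []

  keep-cong : {P : Set} (d : Dec P) {xs ys : List A} → (P → xs ≡ ys) → keep d xs ≡ keep d ys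
  keep-cong (yes p) eq = eq p
  keep-cong (no _)  eq = refl

  ∈-keep⁻ : {P : Set} (d : Dec P) {x : A} {xs : List A} → x ∈ keep d xs → P × x ∈ xs
  ∈-keep⁻ (yes p) x∈ = p , x∈

  keep-true : {P : Set} (d : Dec P) (xs : List A) → P → keep d xs ≡ xs
  keep-true (yes _) xs p = refl
  keep-true (no ¬p) xs p = contradiction p ¬p

  keep-false : {P : Set} (d : Dec P) (xs : List A) → ¬ P → keep d xs ≡ []
  keep-false (yes p) xs ¬p = contradiction p ¬p
  keep-false (no _)  xs ¬p = refl

  keep-unique : {P : Set} (d : Dec P) {xs : List A} → Unique xs → Unique (keep d xs)
  keep-unique (yes _) u = u
  keep-unique (no _)  u = []

  map-keep : {P : Set} (f : A → B) (d : Dec P) (xs : List A) → map f (keep d xs) ≡ keep d (map f xs)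
  map-keep f (yes _) xs = refl
  map-keep f (no _)  xs = refl

  -- The key of an element recovers the index that produced it, so different pieces are disjoint.
  concatMap-unique : ∀ (f : ℕ → List A) (key : A → ℕ) → (∀ i → Unique (f i)) →
                     (∀ i {x} → x ∈ f i → key x ≡ i) → ∀ {is} → Unique is → Unique (concatMap f is)
  concatMap-unique f key unique keyed []              = []
  concatMap-unique f key unique keyed {i ∷ is} (i∉ ∷ u) =
    Unique.++⁺ (unique i) (concatMap-unique f key unique keyed u) disjoint
    where
    disjoint : ∀ {x} → ¬ (x ∈ f i × x ∈ concatMap f is)
    disjoint (x∈fi , x∈rest) with find (∈-concatMap⁻ f {is} x∈rest)
    ... | i′ , i′∈is , x∈fi′ = All.lookup i∉ i′∈is (trans (sym (keyed i x∈fi)) (keyed i′ x∈fi′))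

  -- Unseen times are filled with the default of no arrivals, so the block functions can work with a
  -- total function of time.
  padded : ∀ {n} → Vec (List ℕ) n → ℕ → List ℕ
  padded {n} v u with u <? n
  ... | yes u<n = Vec.lookup v (fromℕ< u<n)
  ... | no  _   = []

  padded-history : ∀ I t u → u ≤ t → padded (history I t) u ≡ arr I u
  padded-history I t u u≤t with u <? suc t
  ... | yes u<1+t = trans (lookup∘tabulate (λ i → arr I (toℕ i)) (fromℕ< u<1+t)) (cong (arr I) (toℕ-fromℕ< u<1+t))
  ... | no  u≮1+t = contradiction (s≤s u≤t) u≮1+t

  -- The algorithm on blocks and its feasibility.

  -- Block i collects the jobs released in [iL , iL + L).  Inside it, local time x is the
  -- slot iL + lam + x, where the calibrations opened at time iL + x become usable.
  module Blocks (T lam L : ℕ) {{L≢0 : NonZero L}} where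
    open EDF T

    origin : ℕ → ℕ
    origin i = i * L + lam

    tasks : ℕ → ℕ → List ℕ → List Task
    tasks o s ds = map (λ f → lookup ds f ∸ o , (s , toℕ f)) (allFin (length ds))

    -- Arrivals stop at local time `L`, while EDF goes on draining the queue of the block.
    arrivals : (ℕ → List ℕ) → ℕ → Arrivals
    arrivals h i x = keep (x <? L) (tasks (origin i) (i * L + x) (h (i * L + x)))

    named : Task × CalId → JobId × CalId
    named (j , c) = proj₂ j , c

    blockRuns : (ℕ → List ℕ) → ℕ → ℕ → List (JobId × CalId)
    blockRuns h t i = keep (origin i ≤? t) (map named (served (i * L) (arrivals h i) (t ∸ origin i)))

    algorithm : OnlineAlg
    algorithm t v = record
      { calibs = opened (arrivals (padded v) (t / L)) (t % L)
      -- Blocks overlap in time, so several may be active. Since `L ≥ 1`, a block with origin at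
      -- most `t` has index at most `t`.
      ; runs   = concatMap (blockRuns (padded v) t) (upTo (suc t))
      }

    ∈-arrivals⁻ : ∀ h i x {j} → j ∈ arrivals h i x →
      x < L × ∃ λ f → j ≡ (lookup (h (i * L + x)) f ∸ origin i , (i * L + x , toℕ f))
    ∈-arrivals⁻ h i x j∈ with ∈-keep⁻ (x <? L) j∈
    ... | x<L , j∈tasks = let f , _ , eq = ∈-map⁻ _ j∈tasks in x<L , f , eq

    ∈-arrivals⁺ : ∀ h i x → x < L → ∀ f → (lookup (h (i * L + x)) f ∸ origin i , (i * L + x , toℕ f)) ∈ arrivals h i x
    ∈-arrivals⁺ h i x x<L f rewrite keep-true (x <? L) (tasks (origin i) (i * L + x) (h (i * L + x))) x<L =
      ∈-map⁺ (λ f → lookup (h (i * L + x)) f ∸ origin i , (i * L + x , toℕ f)) (∈-allFin f)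

    arrivals-unique : ∀ h i x → Unique (arrivals h i x)
    arrivals-unique h i x = keep-unique (x <? L)
      (Unique.map⁺ (λ eq → toℕ-injective (cong (λ j → proj₂ (proj₂ j)) eq)) (Unique.allFin⁺ _))

    -- The density is frozen once arrivals stop. Hence the start time of a calibration, divided by
    -- `L`, tells its block.
    opened⇒<L : ∀ h i y {k} → k < opened (arrivals h i) y → y < L
    opened⇒<L h i zero    _  = >-nonZero⁻¹ L
    opened⇒<L h i (suc y) k< = decidable-stable (suc y <? L) λ y≮L →
      >⇒≢ (≤-<-trans z≤n k<) (opened≡0 (arrivals h i) y (keep-false (suc y <? L) _ y≮L))

    module _ (I : Instance) where

      block : ℕ → Arrivals
      block = arrivals (arr I)

      agree : ∀ t i x → i * L + x ≤ t → AgreeUpTo x (arrivals (padded (history I t)) i) (block i)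
      agree t i x le y y≤x = cong (λ ds → keep (y <? L) (tasks (origin i) (i * L + y) ds))
        (padded-history I t (i * L + y) (≤-trans (+-monoʳ-≤ (i * L) y≤x) le))

      calibs≡ : ∀ t → calibs (dec algorithm I t) ≡ opened (block (t / L)) (t % L)
      calibs≡ t = opened-cong (t % L) (agree t (t / L) (t % L) (≤-reflexive ([m/n]n+m%n≡m t L)))

      calibs-block : ∀ i {y} → y < L → calibs (dec algorithm I (i * L + y)) ≡ opened (block i) y
      calibs-block i y<L = trans (calibs≡ _) (cong₂ (λ i y → opened (block i) y) ([mn+o]/n≡m i y<L) ([mn+o]%n≡o i y<L))

      runs≡ : ∀ t → runs (dec algorithm I t) ≡ concatMap (blockRuns (arr I) t) (upTo (suc t))
      runs≡ t = concatMap-cong (λ i → keep-cong (origin i ≤? t) λ o≤t → cong (map named)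
        (served-cong (i * L) (t ∸ origin i) (agree t i (t ∸ origin i) (begin
          i * L + (t ∸ origin i)      ≤⟨ +-monoˡ-≤ _ (m≤m+n (i * L) lam) ⟩
          origin i + (t ∸ origin i)   ≡⟨ m+[n∸m]≡n o≤t ⟩
          t                           ∎)))) (upTo (suc t))
        where open ≤-Reasoning

      ∈-runs⁻ : ∀ t {p} → p ∈ runs (dec algorithm I t) →
        ∃ λ i → origin i ≤ t × ∃ λ q → q ∈ served (i * L) (block i) (t ∸ origin i) × p ≡ named q
      ∈-runs⁻ t p∈ with find (∈-concatMap⁻ (blockRuns (arr I) t) {upTo (suc t)} (subst (_ ∈_) (runs≡ t) p∈))
      ... | i , _ , p∈i with ∈-keep⁻ (origin i ≤? t) p∈i
      ... | o≤t , p∈map = i , o≤t , ∈-map⁻ named p∈map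

      ∈-runs⁺ : ∀ i x {q} → q ∈ served (i * L) (block i) x → named q ∈ runs (dec algorithm I (origin i + x))
      ∈-runs⁺ i x {q} q∈ = subst (named q ∈_) (sym (runs≡ t)) (∈-concatMap⁺ (blockRuns (arr I) t) (lose i∈ here′))
        where
        t : ℕ
        t = origin i + x
        i∈ : i ∈ upTo (suc t)
        i∈ = ∈-upTo⁺ (s≤s (≤-trans (≤-trans (m≤m*n i L) (m≤m+n (i * L) lam)) (m≤m+n (origin i) x)))
        here′ : named q ∈ blockRuns (arr I) t i
        here′ rewrite keep-true (origin i ≤? t) (map named (served (i * L) (block i) (t ∸ origin i))) (m≤m+n _ x)
                    | m+n∸m≡n (origin i) x = ∈-map⁺ named q∈

      -- Within a block the machines in use are a prefix of a duplicate-free list; across blocks the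
      -- key is the start time divided by `L`.
      runs-unique : ∀ t → Unique (map proj₂ (runs (dec algorithm I t)))
      runs-unique t = subst Unique
        (sym (trans (cong (map proj₂) (runs≡ t)) (map-concatMap proj₂ (blockRuns (arr I) t) (upTo (suc t)))))
        (concatMap-unique (λ i → map proj₂ (blockRuns (arr I) t i)) (λ c → proj₁ c / L) unique keyed (Unique.upTo⁺ (suc t)))
        where
        used : ∀ i → map proj₂ (blockRuns (arr I) t i)
                   ≡ keep (origin i ≤? t) (take (length (queue (block i) (t ∸ origin i))) (machines (i * L) (block i) (t ∸ origin i)))
        used i = trans (map-keep proj₂ (origin i ≤? t) _) (keep-cong (origin i ≤? t) λ _ →
          trans (sym (map-∘ _)) (map-proj₂-zip (queue (block i) (t ∸ origin i)) (machines (i * L) (block i) (t ∸ origin i))))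
        unique : ∀ i → Unique (map proj₂ (blockRuns (arr I) t i))
        unique i = subst Unique (sym (used i)) (keep-unique (origin i ≤? t)
          (Unique.take⁺ (length (queue (block i) (t ∸ origin i))) (machines-unique (i * L) (block i) (t ∸ origin i))))
        keyed : ∀ i {c} → c ∈ map proj₂ (blockRuns (arr I) t i) → proj₁ c / L ≡ i
        keyed i c∈ with ∈-map⁻ proj₂ c∈
        ... | p , p∈ , refl with ∈-keep⁻ (origin i ≤? t) p∈
        ... | _ , p∈map with ∈-map⁻ named p∈map
        ... | q , q∈ , refl with ∈-machines⁻ (i * L) (block i) (t ∸ origin i) (proj₂ (∈-zip⁻ (queue (block i) (t ∸ origin i)) (machines (i * L) (block i) (t ∸ origin i)) q∈))
        ... | y , _ , u≡ , k< = trans (cong (_/ L) u≡) ([mn+o]/n≡m i (opened⇒<L (arr I) i y k<))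

      module _ (wf : WellFormed lam I) (short : ∀ j → deadline I j + L ≤ suc (release I j + lam + T)) where

        origin≤deadline : ∀ i x f → origin i + suc x ≤ lookup (arr I (i * L + x)) f
        origin≤deadline i x f = ≤-trans (≤-reflexive (e (i * L) lam x)) (wf (i * L + x , f))
          where
          e : ∀ a b x → a + b + suc x ≡ a + x + suc b
          e = solve-∀

        -- The last release of the block is at `i * L + L - 1`; for it the `suc` in `short` allows a
        -- deadline of exactly `origin i + T`.
        deadline≤ : ∀ i x f → x < L → lookup (arr I (i * L + x)) f ≤ origin i + T
        deadline≤ i x f x<L = +-cancelʳ-≤ L _ _ (begin
          lookup (arr I (i * L + x)) f + L      ≤⟨ short (i * L + x , f) ⟩
          suc (i * L + x + lam + T)             ≡⟨ e (i * L) x lam T ⟩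
          origin i + T + suc x                  ≤⟨ +-monoʳ-≤ (origin i + T) x<L ⟩
          origin i + T + L                      ∎)
          where
          open ≤-Reasoning
          e : ∀ a x b T → suc (a + x + b + T) ≡ a + b + T + suc x
          e = solve-∀

        block-admissible : ∀ i → Admissible (block i)
        block-admissible i x j∈ with ∈-arrivals⁻ (arr I) i x j∈
        ... | x<L , f , refl =
          m+n≤o⇒m≤o∸n (suc x) (≤-trans (≤-reflexive (+-comm (suc x) (origin i))) (origin≤deadline i x f)) ,
          m≤n+o⇒m∸n≤o _ (origin i) (deadline≤ i x f x<L)

        -- In local time a machine opened at `z` is calibrated on `[z, z + T)`. The current slot is
        -- at least `z`, and it is below `T` because it precedes a deadline of at most `T`.
        legal-run : ∀ t i y z f k → origin i ≤ t → y ≤ t ∸ origin i → z ≤ t ∸ origin i →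
          t ∸ origin i < lookup (arr I (i * L + y)) f ∸ origin i →
          lookup (arr I (i * L + y)) f ∸ origin i ≤ T → k < opened (block i) z →
          LegalRun T lam algorithm I t ((i * L + y , toℕ f) , (i * L + z , k))
        legal-run t i y z f k o≤t y≤x z≤x x<d d≤T k< =
          toℕ<n f , start≤t y≤x , due-in-time ,
          subst (k <_) (sym (calibs-block i (opened⇒<L (arr I) i z k<))) k< , ready , not-over
          where
          open ≤-Reasoning
          x : ℕ
          x = t ∸ origin i
          t≡ : origin i + x ≡ t
          t≡ = m+[n∸m]≡n o≤t
          start≤t : ∀ {y} → y ≤ x → i * L + y ≤ t
          start≤t y≤x = ≤-trans (+-mono-≤ (m≤m+n (i * L) lam) y≤x) (≤-reflexive t≡)
          due-in-time : ∀ f′ → toℕ f′ ≡ toℕ f → suc t ≤ lookup (arr I (i * L + y)) f′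
          due-in-time f′ eq rewrite toℕ-injective eq = begin
            suc t                   ≡⟨ cong suc t≡ ⟨
            suc (origin i + x)      ≡⟨ cong suc (+-comm (origin i) x) ⟩
            suc x + origin i        ≤⟨ m≤o∸n⇒m+n≤o (suc x) (m+n≤o⇒m≤o (origin i) (origin≤deadline i y f)) x<d ⟩
            lookup (arr I (i * L + y)) f  ∎
          ready : i * L + z + lam ≤ t
          ready = begin
            i * L + z + lam   ≡⟨ e (i * L) z lam ⟩
            origin i + z      ≤⟨ +-monoʳ-≤ (origin i) z≤x ⟩
            origin i + x      ≡⟨ t≡ ⟩
            t                 ∎
            where
            e : ∀ a b c → a + b + c ≡ a + c + b
            e = solve-∀
          not-over : t < i * L + z + lam + T
          not-over = begin-strict
            t                       ≡⟨ t≡ ⟨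
            origin i + x            <⟨ +-monoʳ-< (origin i) (≤-trans x<d d≤T) ⟩
            origin i + T            ≤⟨ +-monoˡ-≤ T (+-monoˡ-≤ lam (m≤m+n (i * L) z)) ⟩
            i * L + z + lam + T     ∎

        legal : ∀ t {p} → p ∈ runs (dec algorithm I t) → LegalRun T lam algorithm I t p
        legal t {p} p∈ =
          let i , o≤t , (j , c) , q∈ , p≡ = ∈-runs⁻ t p∈
              j∈ , c∈ = ∈-zip⁻ (queue (block i) (t ∸ origin i)) (machines (i * L) (block i) (t ∸ origin i)) q∈
              y , y≤x , j∈a = queue-origin (block i) (t ∸ origin i) j∈
              z , z≤x , c≡ , k< = ∈-machines⁻ (i * L) (block i) (t ∸ origin i) c∈
              x<d , d≤T = queue-deadline (block-admissible i) (t ∸ origin i) j∈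
              _ , f , j≡ = ∈-arrivals⁻ (arr I) i y j∈a
          in subst (LegalRun T lam algorithm I t) (sym (trans p≡ (cong₂ _,_ (cong proj₂ j≡) (cong (_, proj₂ c) c≡))))
               (legal-run t i y z f (proj₂ c) o≤t y≤x z≤x
                 (subst (λ j → t ∸ origin i < proj₁ j) j≡ x<d) (subst (λ j → proj₁ j ≤ T) j≡ d≤T) k<)

        all-served : ∀ (j : Job I) → ∃ λ t → ∃ λ c → ((proj₁ j , toℕ (proj₂ j)) , c) ∈ runs (dec algorithm I t)
        all-served (s , f) = subst (λ s → ∀ (f : Fin (length (arr I s))) → ∃ λ t → ∃ λ c → ((s , toℕ f) , c) ∈ runs (dec algorithm I t))
          ([m/n]n+m%n≡m s L) go f
          where
          go : ∀ f → ∃ λ t → ∃ λ c → ((s / L * L + s % L , toℕ f) , c) ∈ runs (dec algorithm I t)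
          go f = let x , c , q∈ = eventually-served (block-admissible (s / L)) (s / L * L) (s % L)
                                    (∈-arrivals⁺ (arr I) (s / L) (s % L) (m%n<n s L) f)
                 in origin (s / L) + x , c , ∈-runs⁺ (s / L) x q∈

        feasible : Feasible T lam algorithm I
        feasible = (λ t → All.tabulate (legal t)) , runs-unique , all-served

  -- Counting by injections and double counting.

  pigeonhole : ∀ (R : A → B → Set) → (∀ {x x′ y} → R x y → R x′ y → x ≡ x′) →
    ∀ {xs ys} → Unique xs → (∀ {x} → x ∈ xs → ∃ λ y → y ∈ ys × R x y) → length xs ≤ length ys
  pigeonhole R inj []                         image = z≤n
  pigeonhole R inj {x ∷ xs} (x∉ ∷ unique) image with image (here refl)
  ... | y , y∈ys , Rxy with ∈-∃++ y∈ys
  -- The image of the head is removed from `ys`; injectivity of `R` keeps the images of the other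
  -- elements in what remains.
  ... | ls , rs , refl = ≤-trans (s≤s (pigeonhole R inj unique image′)) (≤-reflexive (sym (↭-length (shift y ls rs))))
    where
    image′ : ∀ {x′} → x′ ∈ xs → ∃ λ y′ → y′ ∈ ls ++ rs × R x′ y′
    image′ x′∈ with image (there x′∈)
    ... | y′ , y′∈ , Rx′y′ with ∈-resp-↭ (shift y ls rs) y′∈
    ... | here refl   = contradiction (inj Rxy Rx′y′) (All.lookup x∉ x′∈)
    ... | there y′∈′  = y′ , y′∈′ , Rx′y′

  sum-applyUpTo : ∀ f n → sum (applyUpTo f n) ≡ ∑ n f
  sum-applyUpTo f zero    = refl
  sum-applyUpTo f (suc n) = trans (cong (f 0 +_) (sum-applyUpTo (f ∘ suc) n)) (sym (∑-split 1 n f))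

  length-concatMap : ∀ (f : A → List B) xs → length (concatMap f xs) ≡ sum (map (length ∘ f) xs)
  length-concatMap f []       = refl
  length-concatMap f (x ∷ xs) = trans (length-++ (f x)) (cong (length (f x) +_) (length-concatMap f xs))

  length-cartesianProduct : ∀ (xs : List A) (ys : List B) → length (cartesianProduct xs ys) ≡ length xs * length ys
  length-cartesianProduct []       ys = refl
  length-cartesianProduct (x ∷ xs) ys = trans (length-++ (map (x ,_) ys))
    (cong₂ _+_ (length-map (x ,_) ys) (length-cartesianProduct xs ys))

  length-filter-indicator : ∀ {P : A → Set} (P? : ∀ x → Dec (P x)) xs →
    length (filter P? xs) ≡ sum (map (indicator ∘ P?) xs)
  length-filter-indicator P? []       = refl
  length-filter-indicator P? (x ∷ xs) with P? x
  ... | yes _ = cong suc (length-filter-indicator P? xs)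
  ... | no  _ = length-filter-indicator P? xs

  ∑-length-filter : ∀ {P : ℕ → A → Set} (P? : ∀ i x → Dec (P i x)) N k →
    (∀ x → ∑ N (λ i → indicator (P? i x)) ≤ k) →
    ∀ xs → ∑ N (λ i → length (filter (P? i) xs)) ≤ length xs * k
  ∑-length-filter P? N k le []       = ≤-reflexive (∑-zero N λ _ _ → refl)
  ∑-length-filter P? N k le (x ∷ xs) = begin
    ∑ N (λ i → length (filter (P? i) (x ∷ xs)))                          ≡⟨ ∑-cong N (λ i _ → first i) ⟩
    ∑ N (λ i → indicator (P? i x) + length (filter (P? i) xs))           ≡⟨ ∑-distrib-+ N _ _ ⟩
    ∑ N (λ i → indicator (P? i x)) + ∑ N (λ i → length (filter (P? i) xs)) ≤⟨ +-mono-≤ (le x) (∑-length-filter P? N k le xs) ⟩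
    k + length xs * k                                                    ∎
    where
    open ≤-Reasoning
    first : ∀ i → length (filter (P? i) (x ∷ xs)) ≡ indicator (P? i x) + length (filter (P? i) xs)
    first i = trans (length-filter-indicator (P? i) (x ∷ xs)) (cong (indicator (P? i x) +_) (sym (length-filter-indicator (P? i) xs)))

  ∑-blocks : ∀ f N L → ∑ (N * L) f ≡ ∑ N (λ i → ∑ L (λ x → f (i * L + x)))
  ∑-blocks f zero    L = refl
  ∑-blocks f (suc N) L = trans (cong (λ n → ∑ n f) (+-comm L (N * L)))
    (trans (∑-split (N * L) L f) (cong (_+ ∑ L (λ x → f (N * L + x))) (∑-blocks f N L)))

  module _ (T L : ℕ) {{L≢0 : NonZero L}} where

    -- The calibrated interval of a calibration started at `u` meets the window of block `i`; the
    -- shift by the activation time, common to both, is left out.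
    Near : ℕ → ℕ → Set
    Near i u = i * L < u + T × u < i * L + T

    near? : ∀ i u → Dec (Near i u)
    near? i u = (i * L <? u + T) ×-dec (u <? i * L + T)

    -- The numbers `i * L` lie strictly between `u - T` and `u + T`, an interval of length at most
    -- `k * L`. Counting down from the largest candidate `last` sends the indices `i` injectively
    -- into `0, …, k - 1`.
    near-count : ∀ k → 2 * T ≤ k * L → ∀ N u → ∑ N (λ i → indicator (near? i u)) ≤ k
    near-count k 2T≤kL N u = begin
      ∑ N (λ i → indicator (near? i u))                 ≡⟨ sum-applyUpTo (λ i → indicator (near? i u)) N ⟨
      sum (applyUpTo (λ i → indicator (near? i u)) N)   ≡⟨ cong sum (map-applyUpTo id (λ i → indicator (near? i u)) N) ⟨
      sum (map (λ i → indicator (near? i u)) (upTo N))  ≡⟨ length-filter-indicator (λ i → near? i u) (upTo N) ⟨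
      length (filter (λ i → near? i u) (upTo N))        ≤⟨ pigeonhole (λ i y → i + y ≡ last) same (Unique.filter⁺ (λ i → near? i u) (Unique.upTo⁺ N)) image ⟩
      length (upTo k)                                   ≡⟨ length-upTo k ⟩
      k                                                 ∎
      where
      open ≤-Reasoning
      last : ℕ
      last = pred (u + T) / L
      same : ∀ {i i′ y} → i + y ≡ last → i′ + y ≡ last → i ≡ i′
      same {i} {i′} {y} p q = +-cancelʳ-≡ y i i′ (trans p (sym q))
      image : ∀ {i} → i ∈ filter (λ i → near? i u) (upTo N) → ∃ λ y → y ∈ upTo k × i + y ≡ last
      image {i} i∈ with ∈-filter⁻ (λ i → near? i u) {xs = upTo N} i∈
      ... | _ , (iL<u+T , u<iL+T) = last ∸ i , ∈-upTo⁺ close , m+[n∸m]≡n i≤last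
        where
        i≤last : i ≤ last
        i≤last = ≤-trans (≤-reflexive (sym (m*n/n≡m i L))) (/-monoˡ-≤ L (<⇒≤pred iL<u+T))
        last<i+k : last < i + k
        last<i+k = m<n*o⇒m/o<n (begin-strict
          pred (u + T)     ≤⟨ pred[n]≤n ⟩
          u + T            <⟨ +-monoˡ-< T u<iL+T ⟩
          i * L + T + T    ≡⟨ e (i * L) T ⟩
          i * L + 2 * T    ≤⟨ +-monoʳ-≤ (i * L) 2T≤kL ⟩
          i * L + k * L    ≡⟨ *-distribʳ-+ L i k ⟨
          (i + k) * L      ∎)
          where
          e : ∀ a T → a + T + T ≡ a + 2 * T
          e = solve-∀
        close : last ∸ i < k
        close = +-cancelˡ-< i _ _ (≤-trans (≤-reflexive (cong suc (m+[n∸m]≡n i≤last))) last<i+k)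

  -- Comparison with an arbitrary offline schedule.

  module Cost (T lam L : ℕ) {{L≢0 : NonZero L}} (k : ℕ) (2T≤kL : 2 * T ≤ k * L)
    (I : Instance) (wf : WellFormed lam I)
    (short : ∀ j → deadline I j + L ≤ suc (release I j + lam + T))
    (S : Schedule T lam I) where

    open EDF T
    open Blocks T lam L

    -- Copy j of a calibration is delayed by j ≤ lam: a job that S runs at τ < r + lam
    -- moves to slot r + lam of the copy delayed by r + lam - τ.
    Copy : Set
    Copy = Fin (length (cals S)) × ℕ

    copies : List Copy
    copies = cartesianProduct (allFin (length (cals S))) (upTo (suc lam))

    startOf : Copy → ℕ
    startOf (c , j) = lookup (cals S) c + j

    touches? : ∀ i (v : Copy) → Dec (Near T L i (startOf v))
    touches? i v = near? T L i (startOf v)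

    touching : ℕ → List Copy
    touching i = filter (touches? i) copies

    delay : Job I → ℕ
    delay J = release I J + lam ∸ proj₂ (place S J)

    copyOf : Job I → Copy
    copyOf J = proj₁ (place S J) , delay J

    -- The later of the time chosen by `S` and `release + lam`.
    slotOf : Job I → ℕ
    slotOf J = proj₂ (place S J) + delay J

    -- Equal copies include equal delays; cancelling these from the slots leaves equal placements in
    -- `S`.
    slot-injective : ∀ J J′ → copyOf J ≡ copyOf J′ → slotOf J ≡ slotOf J′ → J ≡ J′
    slot-injective J J′ c≡ s≡ = inj S (cong₂ _,_ (cong proj₁ c≡)
      (+-cancelʳ-≡ (delay J) _ _ (trans s≡ (cong (proj₂ (place S J′) +_) (sym (cong proj₂ c≡))))))

    delay≤lam : ∀ J → delay J ≤ lam
    delay≤lam J = m≤n+o⇒m∸n≤o _ (proj₂ (place S J)) (+-monoˡ-≤ lam (rel S J))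

    release≤slot : ∀ J → release I J + lam ≤ slotOf J
    release≤slot J = m≤n+m∸n _ (proj₂ (place S J))

    -- Either `S` already runs the job late enough, or the slot is `release + lam`, which
    -- well-formedness places before the deadline.
    slot<deadline : ∀ J → slotOf J < deadline I J
    slot<deadline J with ≤-total (release I J + lam) (proj₂ (place S J))
    ... | inj₁ le rewrite m≤n⇒m∸n≡0 le | +-identityʳ (proj₂ (place S J)) = dl S J
    ... | inj₂ ge rewrite m+[n∸m]≡n ge = ≤-trans (≤-reflexive (sym (+-suc _ lam))) (wf J)

    startOf≤slot : ∀ J → startOf (copyOf J) + lam ≤ slotOf J
    startOf≤slot J = ≤-trans (≤-reflexive (e (lookup (cals S) (proj₁ (place S J))) (delay J) lam)) (+-monoˡ-≤ (delay J) (calLo S J))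
      where
      e : ∀ a b c → a + b + c ≡ a + c + b
      e = solve-∀

    slot<end : ∀ J → slotOf J < startOf (copyOf J) + T + lam
    slot<end J = ≤-trans (+-monoˡ-< (delay J) (calHi S J)) (≤-reflexive (e (lookup (cals S) (proj₁ (place S J))) lam T (delay J)))
      where
      e : ∀ a b c d → a + b + c + d ≡ a + d + c + b
      e = solve-∀

    released-list : (i D b n : ℕ) → List Task
    released-list i D b n = concatMap (λ y → filter (λ j → proj₁ j ≤? D) (block I i y)) (applyUpTo (b +_) n)

    length-released-list : ∀ i D b x → b ≤ x → length (released-list i D b (suc x ∸ b)) ≡ released (block I i) D b x
    length-released-list i D b x b≤x = begin
      length (released-list i D b n)           ≡⟨ length-concatMap _ (applyUpTo (b +_) n) ⟩
      sum (map f (applyUpTo (b +_) n))         ≡⟨ cong sum (map-applyUpTo (b +_) f n) ⟩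
      sum (applyUpTo (λ i → f (b + i)) n)      ≡⟨ sum-applyUpTo (λ i → f (b + i)) n ⟩
      ∑ n (λ i → f (b + i))                    ≡⟨ m+n∸m≡n (∑ b f) _ ⟨
      ∑ b f + ∑ n (λ i → f (b + i)) ∸ ∑ b f    ≡⟨ cong (_∸ ∑ b f) (∑-split b n f) ⟨
      ∑ (b + n) f ∸ ∑ b f                      ≡⟨ cong (λ v → ∑ v f ∸ ∑ b f) (m+[n∸m]≡n (m≤n⇒m≤1+n b≤x)) ⟩
      ∑ (suc x) f ∸ ∑ b f                      ∎
      where
      open ≡-Reasoning
      n : ℕ
      n = suc x ∸ b
      f : ℕ → ℕ
      f y = due D (block I i y)

    -- Every counted task occupies its own pair of copy and slot in the delayed schedule. The slot
    -- is one of the `suc l` slots of the window, and the copy touches the block.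
    released≤touching : ∀ i x b l → b ≤ x → released (block I i) (b + suc l) b x ≤ length (touching i) * suc l
    released≤touching i x b l b≤x = begin
      released (block I i) D b x                        ≡⟨ length-released-list i D b x b≤x ⟨
      length (released-list i D b n)                    ≤⟨ pigeonhole Fits fits-injective unique image ⟩
      length (cartesianProduct (touching i) slots)      ≡⟨ length-cartesianProduct (touching i) slots ⟩
      length (touching i) * length slots                ≡⟨ cong (length (touching i) *_) (length-applyUpTo (origin i + b +_) (suc l)) ⟩
      length (touching i) * suc l                       ∎
      where
      open ≤-Reasoning
      D n : ℕ
      D = b + suc l
      n = suc x ∸ b
      slots : List ℕ
      slots = applyUpTo (origin i + b +_) (suc l)
      Fits : Task → Copy × ℕ → Set
      Fits j (v , τ) = ∃ λ J → j ≡ (deadline I J ∸ origin i , (proj₁ J , toℕ (proj₂ J))) × v ≡ copyOf J × τ ≡ slotOf J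
      fits-injective : ∀ {j j′ y} → Fits j y → Fits j′ y → j ≡ j′
      fits-injective (J , refl , v≡ , τ≡) (J′ , refl , v≡′ , τ≡′)
        rewrite slot-injective J J′ (trans (sym v≡) v≡′) (trans (sym τ≡) τ≡′) = refl
      unique : Unique (released-list i D b n)
      unique = concatMap-unique (λ y → filter (λ j → proj₁ j ≤? D) (block I i y)) (λ j → proj₁ (proj₂ j) ∸ i * L)
        (λ y → Unique.filter⁺ (λ j → proj₁ j ≤? D) (arrivals-unique (arr I) i y))
        keyed
        (Unique.applyUpTo⁺₁ (b +_) n (λ p<q _ eq → <⇒≢ p<q (+-cancelˡ-≡ b _ _ eq)))
        where
        keyed : ∀ y {j} → j ∈ filter (λ j → proj₁ j ≤? D) (block I i y) → proj₁ (proj₂ j) ∸ i * L ≡ y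
        keyed y j∈ with ∈-arrivals⁻ (arr I) i y (proj₁ (∈-filter⁻ (λ j → proj₁ j ≤? D) {xs = block I i y} j∈))
        ... | _ , f , refl = m+n∸m≡n (i * L) y
      image : ∀ {j} → j ∈ released-list i D b n → ∃ λ y → y ∈ cartesianProduct (touching i) slots × Fits j y
      image j∈ with find (∈-concatMap⁻ (λ y → filter (λ j → proj₁ j ≤? D) (block I i y)) {applyUpTo (b +_) n} j∈)
      ... | y , y∈ , j∈y with ∈-applyUpTo⁻ (b +_) y∈ | ∈-filter⁻ (λ j → proj₁ j ≤? D) {xs = block I i y} j∈y
      ... | e , _ , refl | j∈a , d≤D with ∈-arrivals⁻ (arr I) i (b + e) j∈a
      ... | y<L , f , refl = (copyOf J , slotOf J) , ∈-cartesianProduct⁺ copy∈ slot∈ , (J , refl , refl , refl)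
        where
        J : Job I
        J = i * L + (b + e) , f
        o≤slot : origin i + b ≤ slotOf J
        o≤slot = ≤-trans (≤-trans (+-monoʳ-≤ (origin i) (m≤m+n b e)) (≤-reflexive (e₁ (i * L) lam (b + e)))) (release≤slot J)
          where
          e₁ : ∀ a b c → a + b + c ≡ a + c + b
          e₁ = solve-∀
        slot<D : slotOf J < origin i + b + suc l
        slot<D = begin-strict
          slotOf J                                <⟨ slot<deadline J ⟩
          deadline I J                            ≤⟨ m≤n+m∸n (deadline I J) (origin i) ⟩
          origin i + (deadline I J ∸ origin i)    ≤⟨ +-monoʳ-≤ (origin i) d≤D ⟩
          origin i + (b + suc l)                  ≡⟨ +-assoc (origin i) b (suc l) ⟨
          origin i + b + suc l                    ∎
        slot∈ : slotOf J ∈ slots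
        slot∈ = subst (_∈ slots) (m+[n∸m]≡n o≤slot) (∈-applyUpTo⁺ (origin i + b +_)
          (+-cancelˡ-< (origin i + b) _ _ (≤-trans (≤-reflexive (cong suc (m+[n∸m]≡n o≤slot))) slot<D)))
        -- The slot lies both in the calibrated interval of the copy and in the window of the block,
        -- so the two meet; `lam` is cancelled to match `Near`.
        lower : i * L < startOf (copyOf J) + T
        lower = +-cancelʳ-< lam _ _ (begin-strict
          origin i                          ≤⟨ m≤m+n (origin i) b ⟩
          origin i + b                      ≤⟨ o≤slot ⟩
          slotOf J                          <⟨ slot<end J ⟩
          startOf (copyOf J) + T + lam        ∎)
        upper : startOf (copyOf J) < i * L + T
        upper = +-cancelʳ-< lam _ _ (begin-strict
          startOf (copyOf J) + lam      ≤⟨ startOf≤slot J ⟩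
          slotOf J                    <⟨ slot<deadline J ⟩
          deadline I J                ≤⟨ deadline≤ I wf short i (b + e) f y<L ⟩
          i * L + lam + T             ≡⟨ e₁ (i * L) lam T ⟩
          i * L + T + lam             ∎)
          where
          e₁ : ∀ a b c → a + b + c ≡ a + c + b
          e₁ = solve-∀
        copy∈ : copyOf J ∈ touching i
        copy∈ = ∈-filter⁺ (touches? i) (∈-cartesianProduct⁺ (∈-allFin _) (∈-upTo⁺ (s≤s (delay≤lam J)))) (lower , upper)

    -- The openings add up to `cap` at the last local time `L - 1`, which is three times a density.
    block-cost : ∀ i → ∑ L (λ x → calibs (dec algorithm I (i * L + x))) ≤ 3 * length (touching i)
    block-cost i = begin
      ∑ L (λ x → calibs (dec algorithm I (i * L + x)))    ≡⟨ ∑-cong L (λ x x<L → calibs-block I i x<L) ⟩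
      ∑ L (opened (block I i))                            ≡⟨ cong (λ n → ∑ n (opened (block I i))) (suc-pred L) ⟨
      ∑ (suc (pred L)) (opened (block I i))               ≡⟨ ∑opened (block I i) (pred L) ⟩
      3 * density (block I i) (pred L)                    ≤⟨ *-monoʳ-≤ 3 (density-≤ (block I i) (pred L) {length (touching i)} λ b l b≤x _ → released≤touching i (pred L) b l b≤x) ⟩
      3 * length (touching i)                             ∎
      where open ≤-Reasoning

    -- As `L ≥ 1`, the first `N` blocks cover all times below `N`. Exchanging the order of counting,
    -- each copy is charged by at most `k` blocks, and each calibration of `S` has `suc lam` copies.
    cost : ∀ N → algCalibs algorithm I N ≤ 3 * (suc lam * k * length (cals S))
    cost N = begin
      sum (map f (upTo N))                              ≡⟨ cong sum (map-applyUpTo id f N) ⟩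
      sum (applyUpTo f N)                               ≡⟨ sum-applyUpTo f N ⟩
      ∑ N f                                             ≤⟨ ∑-monoˡ-≤ f (m≤m*n N L) ⟩
      ∑ (N * L) f                                       ≡⟨ ∑-blocks f N L ⟩
      ∑ N (λ i → ∑ L (λ x → f (i * L + x)))             ≤⟨ ∑-mono-≤ N (λ i _ → block-cost i) ⟩
      ∑ N (λ i → 3 * length (touching i))               ≡⟨ *-distribˡ-∑ 3 N _ ⟨
      3 * ∑ N (λ i → length (touching i))               ≤⟨ *-monoʳ-≤ 3 (∑-length-filter touches? N k (λ v → near-count T L k 2T≤kL N (startOf v)) copies) ⟩
      3 * (length copies * k)                           ≡⟨ cong (λ c → 3 * (c * k)) length-copies ⟩
      3 * (length (cals S) * suc lam * k)               ≡⟨ cong (3 *_) (e (length (cals S)) (suc lam) k) ⟩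
      3 * (suc lam * k * length (cals S))               ∎
      where
      open ≤-Reasoning
      f : ℕ → ℕ
      f t = calibs (dec algorithm I t)
      length-copies : length copies ≡ length (cals S) * suc lam
      length-copies = trans (length-cartesianProduct (allFin (length (cals S))) (upTo (suc lam)))
        (cong₂ _*_ (length-tabulate {n = length (cals S)} id) (length-upTo (suc lam)))
      e : ∀ a b c → a * b * c ≡ b * c * a
      e = solve-∀

open Combinatorics using (module Blocks; module Cost)

open import Data.Nat using (ℕ; suc) renaming (_≤_ to _≤ℕ_)
open import Data.Integer using (+_)
open import Data.Rational using (ℚ; _<_; _≤_; _+_; _*_; _/_)
open import Data.Integer as ℤ using (ℤ; -[1+_]; +[1+_])
open import Data.Integer.DivMod using ([n/d]*d≤n)
import Data.Integer.Properties as ℤ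
open import Data.Nat as ℕ using (zero; _!)
import Data.Nat.Coprimality as Coprime
import Data.Nat.DivMod as ℕ
import Data.Nat.Properties as ℕ
open import Data.Rational using (mkℚ; 0ℚ; 1ℚ; _-_; -_; _÷_; 1/_; ↥_; ↧_; floor; ceiling; *≤*; *<*; NonNegative; Positive)
open import Data.Rational.Properties
import Data.Rational.Unnormalised as ℚᵘ
import Data.Rational.Unnormalised.Properties as ℚᵘ

-- Embedding the naturals into the rationals; ceilings.

ℕ→ℚ≡mkℚ : ∀ n → ℕ→ℚ n ≡ mkℚ (+ n) 0 (Coprime.sym (Coprime.1-coprimeTo n))
ℕ→ℚ≡mkℚ n = normalize-coprime (Coprime.sym (Coprime.1-coprimeTo n))

ℕ→ℚ-+ : ∀ m n → ℕ→ℚ (m ℕ.+ n) ≡ ℕ→ℚ m + ℕ→ℚ n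
ℕ→ℚ-+ m n rewrite ℕ→ℚ≡mkℚ m | ℕ→ℚ≡mkℚ n =
  cong (_/ 1) (sym (cong₂ ℤ._+_ (ℤ.*-identityʳ (+ m)) (ℤ.*-identityʳ (+ n))))

ℕ→ℚ-* : ∀ m n → ℕ→ℚ (m ℕ.* n) ≡ ℕ→ℚ m * ℕ→ℚ n
ℕ→ℚ-* m n rewrite ℕ→ℚ≡mkℚ m | ℕ→ℚ≡mkℚ n = cong (_/ 1) (ℤ.pos-* m n)

ℕ→ℚ-mono-≤ : ∀ {m n} → m ℕ.≤ n → ℕ→ℚ m ≤ ℕ→ℚ n
ℕ→ℚ-mono-≤ {m} {n} m≤n rewrite ℕ→ℚ≡mkℚ m | ℕ→ℚ≡mkℚ n =
  *≤* (subst₂ ℤ._≤_ (sym (ℤ.*-identityʳ (+ m))) (sym (ℤ.*-identityʳ (+ n))) (ℤ.+≤+ m≤n))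

ℕ→ℚ-cancel-≤ : ∀ {m n} → ℕ→ℚ m ≤ ℕ→ℚ n → m ℕ.≤ n
ℕ→ℚ-cancel-≤ {m} {n} le rewrite ℕ→ℚ≡mkℚ m | ℕ→ℚ≡mkℚ n =
  ℤ.drop‿+≤+ (subst₂ ℤ._≤_ (ℤ.*-identityʳ (+ m)) (ℤ.*-identityʳ (+ n)) (drop-*≤* le))

ℕ→ℚ-nonNeg : ∀ n → NonNegative (ℕ→ℚ n)
ℕ→ℚ-nonNeg n = normalize-nonNeg n 1

p≤p+nonNeg : ∀ p q .{{_ : NonNegative q}} → p ≤ p + q
p≤p+nonNeg p q = subst (_≤ p + q) (+-identityʳ p) (+-monoʳ-≤ p (nonNegative⁻¹ q))

floor*↧≤↥ : ∀ p → floor p ℤ.* ↧ p ℤ.≤ ↥ p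
floor*↧≤↥ p@record{} = [n/d]*d≤n (↥ p) (↧ p)

-- `ceiling p` is `- floor (- p)`, so this is the negated floor bound for `- p`.
≤-ceiling : ∀ p → p ≤ ℤ→ℚ (ceiling p)
≤-ceiling p@record{} = toℚᵘ-cancel-≤ (ℚᵘ.≤-respʳ-≃ (ℚᵘ.≃-sym (toℚᵘ-fromℚᵘ (ℚᵘ.mkℚᵘ (ceiling p) 0))) (ℚᵘ.*≤* bound))
  where
  open ℤ.≤-Reasoning
  f : ℤ
  f = floor (- p)
  bound : ↥ p ℤ.* + 1 ℤ.≤ ceiling p ℤ.* ↧ p
  bound = begin
    ↥ p ℤ.* + 1            ≡⟨ ℤ.*-identityʳ (↥ p) ⟩
    ↥ p                    ≡⟨ ℤ.neg-involutive (↥ p) ⟨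
    ℤ.- (ℤ.- ↥ p)          ≡⟨ cong ℤ.-_ (↥-neg p) ⟨
    ℤ.- (↥ (- p))          ≤⟨ ℤ.neg-mono-≤ (floor*↧≤↥ (- p)) ⟩
    ℤ.- (f ℤ.* ↧ (- p))    ≡⟨ ℤ.neg-distribˡ-* f (↧ (- p)) ⟩
    ceiling p ℤ.* ↧ (- p)  ≡⟨ cong (ceiling p ℤ.*_) (↧-neg p) ⟩
    ceiling p ℤ.* ↧ p      ∎

-- The constants of the ratio and the choice of block length.

positive⇒ℕ : ∀ z → 0ℚ < ℤ→ℚ z → ∃ λ k → z ≡ + k
positive⇒ℕ (+ k)    _   = k , refl
positive⇒ℕ -[1+ m ] 0<z rewrite ℕ→ℚ≡mkℚ (suc m) with 0<z
... | *<* ()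

-- The split repeats the one in `ceil2div1minus` so that the latter computes; positivity of `1 - α`,
-- carried through the split, excludes the last two cases.
ceil2div1minus-spec : ∀ α → α < 1ℚ → ∃ λ k → ceil2div1minus α ≡ + k × ℕ→ℚ 2 ≤ ℕ→ℚ k * (1ℚ - α)
ceil2div1minus-spec α α<1 with 1ℚ - α | subst (_< 1ℚ - α) (+-inverseʳ α) (+-monoˡ-< (- α) α<1)
... | q@(mkℚ +[1+ n ] _ _) | _ = k , c≡k , (begin
  ℕ→ℚ 2                  ≡⟨ *-identityʳ (ℕ→ℚ 2) ⟨
  ℕ→ℚ 2 * 1ℚ             ≡⟨ cong (ℕ→ℚ 2 *_) (*-inverseˡ q) ⟨
  ℕ→ℚ 2 * (1/ q * q)     ≡⟨ *-assoc (ℕ→ℚ 2) (1/ q) q ⟨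
  ℕ→ℚ 2 ÷ q * q          ≤⟨ *-monoʳ-≤-nonNeg q (≤-ceiling (ℕ→ℚ 2 ÷ q)) ⟩
  ℤ→ℚ c * q              ≡⟨ cong (λ z → ℤ→ℚ z * q) c≡k ⟩
  ℕ→ℚ k * q              ∎)
  where
  open ≤-Reasoning
  c : ℤ
  c = ceiling (ℕ→ℚ 2 ÷ q)
  instance
    1/q-pos : Positive (1/ q)
    1/q-pos = 1/pos⇒pos q
  natural : ∃ λ k → c ≡ + k
  natural = positive⇒ℕ c (<-≤-trans (positive⁻¹ (ℕ→ℚ 2 ÷ q) {{pos*pos⇒pos (ℕ→ℚ 2) (1/ q)}}) (≤-ceiling (ℕ→ℚ 2 ÷ q)))
  k : ℕ
  k = proj₁ natural
  c≡k : c ≡ + k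
  c≡k = proj₂ natural
... | q@(mkℚ -[1+ n ] _ _) | *<* ()
... | mkℚ (+ zero) _ _     | *<* (ℤ.+<+ ())

2≤eSum : ∀ n → ℕ→ℚ 2 ≤ eSum (suc n)
2≤eSum zero    = ≤-refl
2≤eSum (suc n) = ≤-trans (2≤eSum n) (p≤p+nonNeg (eSum (suc n)) _ {{normalize-nonNeg 1 (suc (suc n) !) {{suc (suc n) ℕ.!≢0}}}})

-- The first two terms of the exponential series already give 2, which turns the factor 3 of the
-- algorithm into at most `q + 1`.
aboveE⇒2≤ : ∀ {q} → AboveE q → ℕ→ℚ 2 ≤ q
aboveE⇒2≤ (n , eU≤q) = ≤-trans (≤-trans (2≤eSum n) (p≤p+nonNeg (eSum (suc n)) _
  {{normalize-nonNeg 1 (suc n ℕ.* suc n !) {{ℕ.m*n≢0 (suc n) (suc n !) {{_}} {{suc n ℕ.!≢0}}}}}})) eU≤q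

-- Here `w` is the window length beyond `lam`, so `w < αT`; then `kw + 2T ≤ kαT + k(1 - α)T = kT`.
short-slack : ∀ α T lam k w → ℕ→ℚ 2 ≤ ℕ→ℚ k * (1ℚ - α) → ℕ→ℚ (w ℕ.+ lam) < α * ℕ→ℚ T + ℕ→ℚ lam →
              k ℕ.* w ℕ.+ 2 ℕ.* T ℕ.≤ k ℕ.* T
short-slack α T lam k w 2≤ short = ℕ→ℚ-cancel-≤ (begin
  ℕ→ℚ (k ℕ.* w ℕ.+ 2 ℕ.* T)                         ≡⟨ ℕ→ℚ-+ (k ℕ.* w) (2 ℕ.* T) ⟩
  ℕ→ℚ (k ℕ.* w) + ℕ→ℚ (2 ℕ.* T)                     ≡⟨ cong₂ _+_ (ℕ→ℚ-* k w) (ℕ→ℚ-* 2 T) ⟩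
  ℕ→ℚ k * ℕ→ℚ w + ℕ→ℚ 2 * ℕ→ℚ T                     ≤⟨ +-mono-≤ (*-monoˡ-≤-nonNeg (ℕ→ℚ k) {{ℕ→ℚ-nonNeg k}} (<⇒≤ w<αT)) (*-monoʳ-≤-nonNeg (ℕ→ℚ T) {{ℕ→ℚ-nonNeg T}} 2≤) ⟩
  ℕ→ℚ k * (α * ℕ→ℚ T) + ℕ→ℚ k * (1ℚ - α) * ℕ→ℚ T    ≡⟨ cong (_+ ℕ→ℚ k * (1ℚ - α) * ℕ→ℚ T) (*-assoc (ℕ→ℚ k) α (ℕ→ℚ T)) ⟨
  ℕ→ℚ k * α * ℕ→ℚ T + ℕ→ℚ k * (1ℚ - α) * ℕ→ℚ T      ≡⟨ *-distribʳ-+ (ℕ→ℚ T) (ℕ→ℚ k * α) (ℕ→ℚ k * (1ℚ - α)) ⟨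
  (ℕ→ℚ k * α + ℕ→ℚ k * (1ℚ - α)) * ℕ→ℚ T            ≡⟨ cong (_* ℕ→ℚ T) (*-distribˡ-+ (ℕ→ℚ k) α (1ℚ - α)) ⟨
  ℕ→ℚ k * (α + (1ℚ - α)) * ℕ→ℚ T                    ≡⟨ cong (λ p → ℕ→ℚ k * p * ℕ→ℚ T) α+[1-α]≡1 ⟩
  ℕ→ℚ k * 1ℚ * ℕ→ℚ T                                ≡⟨ cong (_* ℕ→ℚ T) (*-identityʳ (ℕ→ℚ k)) ⟩
  ℕ→ℚ k * ℕ→ℚ T                                     ≡⟨ ℕ→ℚ-* k T ⟨
  ℕ→ℚ (k ℕ.* T)                                     ∎)
  where
  open ≤-Reasoning
  cancel : ∀ p q → p + q - q ≡ p
  cancel p q = trans (+-assoc p q (- q)) (trans (cong (λ r → p + r) (+-inverseʳ q)) (+-identityʳ p))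
  w<αT : ℕ→ℚ w < α * ℕ→ℚ T
  w<αT = subst₂ _<_ (trans (cong (_- ℕ→ℚ lam) (ℕ→ℚ-+ w lam)) (cancel (ℕ→ℚ w) (ℕ→ℚ lam))) (cancel (α * ℕ→ℚ T) (ℕ→ℚ lam))
           (+-monoˡ-< (- ℕ→ℚ lam) short)
  α+[1-α]≡1 : α + (1ℚ - α) ≡ 1ℚ
  α+[1-α]≡1 = trans (+-comm α (1ℚ - α)) (trans (+-assoc 1ℚ (- α) α)
    (trans (cong (λ r → 1ℚ + r) (+-inverseˡ α)) (+-identityʳ 1ℚ)))

module _ (k T : ℕ) {{k≢0 : ℕ.NonZero k}} where

  -- ⌈2T/k⌉
  blockLength : ℕ
  blockLength = suc ((2 ℕ.* T ℕ.∸ 1) ℕ./ k)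

  2T≤k*blockLength : 2 ℕ.* T ≤ℕ k ℕ.* blockLength
  2T≤k*blockLength = begin
    2 ℕ.* T                                         ≤⟨ ℕ.m≤n+m∸n (2 ℕ.* T) 1 ⟩
    suc X                                           ≡⟨ cong suc (ℕ.m≡m%n+[m/n]*n X k) ⟩
    suc (X ℕ.% k) ℕ.+ X ℕ./ k ℕ.* k                 ≤⟨ ℕ.+-monoˡ-≤ _ (ℕ.m%n<n X k) ⟩
    blockLength ℕ.* k                               ≡⟨ ℕ.*-comm blockLength k ⟩
    k ℕ.* blockLength                               ∎
    where
    open ℕ.≤-Reasoning
    X : ℕ
    X = 2 ℕ.* T ℕ.∸ 1

  -- The slack says that `T - w` is at least `2T/k`; being an integer, it is at least the rounded-up
  -- quotient.
  window+blockLength≤ : 1 ≤ℕ T → ∀ w → k ℕ.* w ℕ.+ 2 ℕ.* T ≤ℕ k ℕ.* T → w ℕ.+ blockLength ≤ℕ T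
  window+blockLength≤ T≥1 w slack = subst (_≤ℕ T) (sym (ℕ.+-suc w m)) (ℕ.*-cancelˡ-< k (w ℕ.+ m) T (begin-strict
    k ℕ.* (w ℕ.+ m)                  ≡⟨ ℕ.*-distribˡ-+ k w m ⟩
    k ℕ.* w ℕ.+ k ℕ.* m              ≡⟨ cong (k ℕ.* w ℕ.+_) (ℕ.*-comm k m) ⟩
    k ℕ.* w ℕ.+ m ℕ.* k              ≤⟨ ℕ.+-monoʳ-≤ (k ℕ.* w) (ℕ.m/n*n≤m (2 ℕ.* T ℕ.∸ 1) k) ⟩
    k ℕ.* w ℕ.+ (2 ℕ.* T ℕ.∸ 1)      <⟨ ℕ.+-monoʳ-< (k ℕ.* w) (ℕ.≤-reflexive (ℕ.m+[n∸m]≡n (ℕ.≤-trans T≥1 (ℕ.m≤n*m T 2)))) ⟩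
    k ℕ.* w ℕ.+ 2 ℕ.* T              ≤⟨ slack ⟩
    k ℕ.* T                          ∎))
    where
    open ℕ.≤-Reasoning
    m : ℕ
    m = (2 ℕ.* T ℕ.∸ 1) ℕ./ k

window-bound : ∀ α T lam k {{k≢0 : ℕ.NonZero k}} → 1 ≤ℕ T → ℕ→ℚ 2 ≤ ℕ→ℚ k * (1ℚ - α) →
  ∀ I → WellFormed lam I → AlphaShort α T lam I →
  ∀ j → deadline I j ℕ.+ blockLength k T ≤ℕ suc (release I j ℕ.+ lam ℕ.+ T)
window-bound α T lam k T≥1 2≤ I wf short j = begin
  deadline I j ℕ.+ L                  ≡⟨ cong (ℕ._+ L) d≡ ⟩
  r ℕ.+ lam ℕ.+ w ℕ.+ L               ≡⟨ ℕ.+-assoc (r ℕ.+ lam) w L ⟩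
  r ℕ.+ lam ℕ.+ (w ℕ.+ L)             ≤⟨ ℕ.+-monoʳ-≤ (r ℕ.+ lam) (window+blockLength≤ k T T≥1 w slack) ⟩
  r ℕ.+ lam ℕ.+ T                     ≤⟨ ℕ.n≤1+n _ ⟩
  suc (r ℕ.+ lam ℕ.+ T)               ∎
  where
  open ℕ.≤-Reasoning
  L r w : ℕ
  L = blockLength k T
  r = release I j
  w = deadline I j ℕ.∸ (r ℕ.+ lam)
  d≡ : deadline I j ≡ r ℕ.+ lam ℕ.+ w
  d≡ = sym (ℕ.m+[n∸m]≡n (ℕ.≤-trans (ℕ.+-monoʳ-≤ r (ℕ.n≤1+n lam)) (wf j)))
  d∸r≡ : deadline I j ℕ.∸ r ≡ w ℕ.+ lam
  d∸r≡ = trans (cong (ℕ._∸ r) (trans d≡ (e r lam w))) (ℕ.m+n∸m≡n r (w ℕ.+ lam))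
    where
    e : ∀ r l w → r ℕ.+ l ℕ.+ w ≡ r ℕ.+ (w ℕ.+ l)
    e = solve-∀
  slack : k ℕ.* w ℕ.+ 2 ℕ.* T ≤ℕ k ℕ.* T
  slack = short-slack α T lam k w 2≤ (subst (λ n → ℕ→ℚ n < α * ℕ→ℚ T + ℕ→ℚ lam) d∸r≡ (short j))

-- The competitive ratio.

ratio-bound : ∀ {q} → ℕ→ℚ 2 ≤ q → ∀ {c z} a b n → z ≡ + b → c ≤ℕ 3 ℕ.* (a ℕ.* b ℕ.* n) →
              ℕ→ℚ c ≤ (q + 1ℚ) * ℕ→ℚ a * ℤ→ℚ z * ℕ→ℚ n + ℕ→ℚ 0
ratio-bound {q} 2≤q {c} a b n refl c≤ = begin
  ℕ→ℚ c                                         ≤⟨ ℕ→ℚ-mono-≤ c≤ ⟩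
  ℕ→ℚ (3 ℕ.* (a ℕ.* b ℕ.* n))                   ≡⟨ cong ℕ→ℚ (e a b n) ⟩
  ℕ→ℚ (3 ℕ.* a ℕ.* b ℕ.* n)                     ≡⟨ ℕ→ℚ-* (3 ℕ.* a ℕ.* b) n ⟩
  ℕ→ℚ (3 ℕ.* a ℕ.* b) * ℕ→ℚ n                   ≡⟨ cong (_* ℕ→ℚ n) (ℕ→ℚ-* (3 ℕ.* a) b) ⟩
  ℕ→ℚ (3 ℕ.* a) * ℕ→ℚ b * ℕ→ℚ n                 ≡⟨ cong (λ p → p * ℕ→ℚ b * ℕ→ℚ n) (ℕ→ℚ-* 3 a) ⟩
  ℕ→ℚ 3 * ℕ→ℚ a * ℕ→ℚ b * ℕ→ℚ n                 ≤⟨ up n (up b (up a (+-monoˡ-≤ 1ℚ 2≤q))) ⟩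
  (q + 1ℚ) * ℕ→ℚ a * ℕ→ℚ b * ℕ→ℚ n              ≡⟨ +-identityʳ _ ⟨
  (q + 1ℚ) * ℕ→ℚ a * ℕ→ℚ b * ℕ→ℚ n + ℕ→ℚ 0      ∎
  where
  open ≤-Reasoning
  up : ∀ m {p p′} → p ≤ p′ → p * ℕ→ℚ m ≤ p′ * ℕ→ℚ m
  up m = *-monoʳ-≤-nonNeg (ℕ→ℚ m) {{ℕ→ℚ-nonNeg m}}
  e : ∀ a b n → 3 ℕ.* (a ℕ.* b ℕ.* n) ≡ 3 ℕ.* a ℕ.* b ℕ.* n
  e = solve-∀

theorem2 : (α : ℚ) → (+ 0 / 1) < α → α < (+ 1 / 1) →
    (lam : ℕ) → (T : ℕ) → 1 ≤ℕ T →
    Σ OnlineAlg λ A → Σ ℕ λ a →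
    ∀ (I : Instance) → WellFormed lam I → AlphaShort α T lam I →
    Feasible T lam A I
    × (∀ (S : Schedule T lam I) (q : ℚ) → AboveE q → (N : ℕ) →
    ℕ→ℚ (algCalibs A I N)
    ≤ (q + (+ 1 / 1)) * ℕ→ℚ (suc lam) * ℤ→ℚ (ceil2div1minus α)
    * ℕ→ℚ (length (cals S)) + ℕ→ℚ a)
theorem2 α _ α<1 lam T T≥1 with ceil2div1minus-spec α α<1
-- A zero ceiling would give `2 ≤ 0 * (1 - α)`; excluding it provides the nonzero divisor in
-- `blockLength`.
... | zero , _ , 2≤0 = contradiction (≤-trans 2≤0 (≤-reflexive (*-zeroˡ (1ℚ - α)))) λ { (*≤* (ℤ.+≤+ ())) }
... | k@(suc _) , ceil≡k , 2≤ = Blocks.algorithm T lam L , 0 , λ I wf short →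
        let bound = window-bound α T lam k T≥1 2≤ I wf short in
        Blocks.feasible T lam L I wf bound ,
        λ S q q>e N → ratio-bound (aboveE⇒2≤ q>e) (suc lam) k (length (cals S)) ceil≡k
          (Cost.cost T lam L k (2T≤k*blockLength k T) I wf bound S N)
  where
  L : ℕ
  L = blockLength k T
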